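{- Let $D$ be a strongly connected balanced bipartite digraph of order $2a$, where $a\geq 3$, and let $k$ be an integer satisfying $\max\{1,\frac{a}{4}\}<k\leq\frac{a}{2}$. Suppose that for every dominated pair $\{u,v\}$ of vertices in $D$, \[ d(u)\geq 2a-k\ \text{and}\ d(v)\geq a+k,\quad\text{or}\quad d(u)\geq a+k\ \text{and}\ d(v)\geq 2a-k. \] Then $D$ is either bipancyclic or a directed cycle of length $2a$.
   Context: Digraphs have no loops and no multiple arcs. For a vertex $v$, $d(v)=d^+(v)+d^-(v)$ (out-degree plus in-degree). A pair of distinct vertices $\{u,v\}$ is dominated if there is a vertex $w$ with $wu$ and $wv$ both arcs of $D$. Balanced bipartite: two partite sets of equal size. Bipancyclic: contains directed cycles of all even lengths $2,4,\dots,2a$. -}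

module Defs where

open import Data.Nat using (ℕ; zero; suc; _+_; _*_; _≤_; _<_)
open import Data.Bool using (Bool; true; false)
open import Data.Fin using (Fin; zero; suc; inject₁; fromℕ)
open import Data.Sum using (_⊎_; inj₁; inj₂)
open import Data.Product using (Σ; ∃; _×_; _,_)
open import Function using (_∘_)
open import Function.Definitions using (Injective)
open import Relation.Binary.PropositionalEquality using (_≡_; _≢_)
open import Relation.Binary.Construct.Closure.ReflexiveTransitive using (Star)

-- Vertex set of a balanced bipartite digraph of order 2a:
-- partite set X = inj₁ (Fin a), partite set Y = inj₂ (Fin a).
V : ℕ → Set
V a = Fin a ⊎ Fin a

-- A balanced bipartite digraph with partite sets of size a.
-- Arcs are given by a Boolean adjacency relation (so no multiple arcs);
-- every arc joins the two partite sets (so in particular no loops).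
record BipDigraph (a : ℕ) : Set where
  field
    arc      : V a → V a → Bool
    noArcXX  : ∀ i j → arc (inj₁ i) (inj₁ j) ≡ false
    noArcYY  : ∀ i j → arc (inj₂ i) (inj₂ j) ≡ false
open BipDigraph public

Arc : ∀ {a} → BipDigraph a → V a → V a → Set
Arc D u v = arc D u v ≡ true

countFin : ∀ {n} → (Fin n → Bool) → ℕ
countFin {zero}  f = 0
countFin {suc n} f with f zero
... | true  = suc (countFin (f ∘ suc))
... | false = countFin (f ∘ suc)

countV : ∀ {a} → (V a → Bool) → ℕ
countV f = countFin (f ∘ inj₁) + countFin (f ∘ inj₂)

outdeg indeg deg : ∀ {a} → BipDigraph a → V a → ℕ
outdeg D v = countV (λ w → arc D v w)
indeg  D v = countV (λ w → arc D w v)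
deg D v = outdeg D v + indeg D v

StronglyConnected : ∀ {a} → BipDigraph a → Set
StronglyConnected D = ∀ u v → Star (Arc D) u v

Dominated : ∀ {a} → BipDigraph a → V a → V a → Set
Dominated D u v = u ≢ v × ∃ λ w → Arc D w u × Arc D w v

-- A directed cycle of length suc n given by a sequence of suc n distinct
-- vertices c 0 → c 1 → … → c n → c 0.
record CycleOf {a} (D : BipDigraph a) (n : ℕ) : Set where
  field
    vtx    : Fin (suc n) → V a
    inj    : Injective _≡_ _≡_ vtx
    step   : ∀ (i : Fin n) → Arc D (vtx (inject₁ i)) (vtx (suc i))
    close  : Arc D (vtx (fromℕ n)) (vtx zero)
open CycleOf public

HasCycleOfLength : ∀ {a} → BipDigraph a → ℕ → Set
HasCycleOfLength D zero    = Data.Empty.⊥ where import Data.Empty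
HasCycleOfLength D (suc n) = CycleOf D n

Bipancyclic : ∀ {a} → BipDigraph a → Set
Bipancyclic {a} D = ∀ t → 1 ≤ t → t ≤ a → HasCycleOfLength D (2 * t)

-- D itself is a directed cycle of length 2a: it has a cycle through
-- 2a distinct vertices (i.e. all vertices) and every arc of D is an arc
-- of that cycle.
IsDirectedCycle : ∀ {a} → BipDigraph a → Set
IsDirectedCycle {zero}  D = Data.Empty.⊥ where import Data.Empty
IsDirectedCycle {suc a} D =
  Σ (CycleOf D (a + suc a)) λ C →
    ∀ u v → Arc D u v →
      (∃ λ (i : Fin (a + suc a)) → u ≡ vtx C (inject₁ i) × v ≡ vtx C (suc i))
      ⊎ (u ≡ vtx C (fromℕ (a + suc a)) × v ≡ vtx C zero)

{-# OPTIONS --safe #-}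
-- If every vertex has at most one out-neighbour, D is a directed cycle.  Otherwise high degrees spread along arcs:
-- every vertex has degree at least a + k, and one of any two vertices dominated together is high, i.e. of degree
-- at least 2a − k.  A longest path in the graph of pairs joined by arcs in both directions, rotated so as to start
-- at a high vertex, closes to a cycle of length 2r with r ≥ a − k ≥ a/2; if it spans D, counting the windows of the
-- cycle around a high vertex x gives one with r = a − k.  From there cycles grow by one pair at a time: when a
-- cycle with 2r > a cannot be enlarged, no high vertex outside is joined both ways to another outside vertex, and
-- exchanging vertices between the cycle and its outside bounds a degree sum below 3a, a contradiction; when
-- 2r = a, the outside is complete, and strong connectivity provides a longer cycle through it.  Finally, a cycle of
-- length 2(a − 1) yields all shorter ones through a vertex x off it, again by counting x → yᵢ and yᵢ₊ₚ → x.
module Submission where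

open import Defs
open import Data.Bool using (Bool; true; false)
import Data.Bool.Properties as Bool
open import Data.Nat using (ℕ; zero; suc; _+_; _*_; _∸_; _≤_; _<_; z≤n; s≤s; _≤?_; _<?_)
open import Data.Nat.Properties
  using (≤-refl; ≤-trans; ≤-reflexive; ≤-antisym; +-mono-≤; +-comm; +-assoc; +-identityʳ; m≤m+n; m≤n+m; ≮⇒≥; <⇒≤; <⇒≱; n≮n; m+[n∸m]≡n; m∸n+n≡m; m∸n≡0⇒m≤n; m∸n≤m; ≤-pred; m≤n⇒m<n∨m≡n; suc-injective; +-suc; *-identityʳ; +-cancelˡ-≤; +-cancelˡ-≡; +-cancelʳ-≤; +-monoˡ-≤; +-monoʳ-≤)
open import Data.Nat.ListAction using (sum)
open import Data.Nat.ListAction.Properties using (sum-↭)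
open import Data.Nat.Tactic.RingSolver using (solve; solve-∀)
open import Data.Fin using (Fin; zero; suc; inject₁; fromℕ)
import Data.Fin as Fin
import Data.Fin.Properties as Fin
open import Data.List using (List; []; _∷_; _++_; [_]; map; length; allFin; filter; reverse; tabulate; lookup)
open import Data.List.Properties
  using (map-++; map-∘; length-map; length-++; length-tabulate; ++-assoc; unfold-reverse; ∷-injective)
open import Data.List.Membership.Propositional using (_∈_; _∉_; lose; find)
open import Data.List.Membership.Propositional.Properties
  using (∈-∃++; ∈-allFin; ∈-++⁺ˡ; ∈-++⁺ʳ; ∈-++⁻; ∈-insert; ∈-map⁺; ∈-map⁻; ∈-filter⁻; ∈-lookup)
open import Data.List.Relation.Unary.Any using (Any; here; there)
import Data.List.Relation.Unary.Any as Any
open import Data.List.Relation.Unary.All using (All; []; _∷_)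
import Data.List.Relation.Unary.All as All
import Data.List.Relation.Unary.All.Properties as All
open import Data.List.Relation.Unary.AllPairs using ([]; _∷_)
open import Data.List.Relation.Unary.Unique.Propositional using (Unique)
import Data.List.Relation.Unary.Unique.Propositional.Properties as Unique
import Data.List.Relation.Unary.Unique.DecPropositional as DecUnique
open import Data.List.Relation.Binary.Permutation.Propositional
  using (_↭_; ↭-refl; ↭-sym; ↭-trans; ↭-reflexive; ↭⇒↭ₛ; prep)
open import Data.List.Relation.Binary.Permutation.Propositional.Properties
  using (shift; ↭-length; ↭-reverse; ∈-resp-↭; drop-∷; ++⁺ʳ)
  renaming (map⁺ to ↭-map⁺; ++-comm to ↭-++-comm)
import Data.List.Relation.Binary.Permutation.Setoid.Properties as PermutationSetoid
open import Data.Product using (∃; ∃₂; _×_; _,_; proj₁; proj₂)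
open import Data.Sum using (_⊎_; inj₁; inj₂)
import Data.Sum as Sum
import Data.Sum.Properties as Sum
open import Data.Empty using (⊥; ⊥-elim)
open import Function using (_∘_; case_of_)
open import Relation.Nullary using (¬_; Dec; yes; no)
open import Relation.Nullary.Decidable using (_×-dec_; _⊎-dec_; ¬?; map′; decidable-stable)
open import Relation.Unary using (Decidable)
open import Relation.Binary.Definitions using (tri<; tri≈; tri>)
open import Relation.Binary.PropositionalEquality
  using (_≡_; _≢_; refl; sym; trans; cong; cong₂; subst; setoid)
open import Relation.Binary.Construct.Closure.ReflexiveTransitive using (Star; ε; _◅_)

-- Where 3a comes from: a high vertex and any other vertex have degree sum at least (2a - k) + (a +
-- k), in which k cancels. A pair joined both ways off a cycle of r pairs that cannot be enlarged
-- has at most 2r arcs with the cycle and 2(a - r) per vertex with the outside. The total 4a - 2r is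
-- below 3a exactly when 2r > a, so a start at r ≥ a/2 leaves a single boundary case. Growth says
-- nothing about lengths below the start; these have to come down from a - 1 pairs. A vertex missed
-- by such a cycle keeps at least a + k - 2 > a - 1 arcs with it, enough for the count to succeed at
-- every window length. A spanning cycle misses no vertex, which is the obstacle that makes the
-- descent to a - k necessary before growing again. Whether a cycle of a given length exists is
-- settled by finite search, so each enlargement may be argued by contradiction.

-- An unambiguous cons for the variable lists given to solve: resolving the overloaded _∷_ there takes
-- time exponential in their length.
infixr 5 _&_
pattern _&_ x xs = List._∷_ x xs

-- A linear inequality is refuted by adding hypotheses up to L ≤ R with L ≡ 1 + R + s.
impossible : ∀ {L R} s → L ≤ R → L ≡ suc (R + s) → ⊥
impossible {R = R} s L≤R refl = n≮n R (≤-trans (s≤s (m≤m+n R s)) L≤R)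

infixr 5 _⊕_
_⊕_ : ∀ {i j m n} → i ≤ j → m ≤ n → i + m ≤ j + n
_⊕_ = +-mono-≤

by-contradiction-≤ : ∀ {m n} → (n < m → ⊥) → m ≤ n
by-contradiction-≤ = ≮⇒≥

-- Lists without repetition.

module _ {A : Set} where

  Unique-resp-↭ : {xs ys : List A} → xs ↭ ys → Unique xs → Unique ys
  Unique-resp-↭ p = PermutationSetoid.Unique-resp-↭ (setoid A) (↭⇒↭ₛ p)

  Unique-∷⁺ : {x : A} {xs : List A} → x ∉ xs → Unique xs → Unique (x ∷ xs)
  Unique-∷⁺ x∉ u = All.¬Any⇒All¬ _ x∉ ∷ u

  Unique-∷⁻ : {x : A} {xs : List A} → Unique (x ∷ xs) → x ∉ xs
  Unique-∷⁻ = Unique.Unique[x∷xs]⇒x∉xs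

  Unique-tail : {x : A} {xs : List A} → Unique (x ∷ xs) → Unique xs
  Unique-tail (_ ∷ u) = u

  Unique-++⁻ˡ : (xs : List A) {ys : List A} → Unique (xs ++ ys) → Unique xs
  Unique-++⁻ˡ []       u       = []
  Unique-++⁻ˡ (x ∷ xs) (p ∷ u) = All.++⁻ˡ xs p ∷ Unique-++⁻ˡ xs u

  Unique-++⁻ʳ : (xs : List A) {ys : List A} → Unique (xs ++ ys) → Unique ys
  Unique-++⁻ʳ []       u       = u
  Unique-++⁻ʳ (x ∷ xs) (p ∷ u) = Unique-++⁻ʳ xs u

  Unique-++⁻-disjoint : (xs : List A) {ys : List A} {z : A} → Unique (xs ++ ys) → z ∈ ys → z ∉ xs
  Unique-++⁻-disjoint (x ∷ xs) u       z∈ (here refl) = Unique-∷⁻ u (∈-++⁺ʳ xs z∈)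
  Unique-++⁻-disjoint (x ∷ xs) (_ ∷ u) z∈ (there z∈′) = Unique-++⁻-disjoint xs u z∈ z∈′

  ∈-++-∷⁻ : (xs : List A) {ys : List A} {x z : A} → z ∈ xs ++ x ∷ ys → z ≢ x → z ∈ xs ++ ys
  ∈-++-∷⁻ []       (here z≡x) z≢x = ⊥-elim (z≢x z≡x)
  ∈-++-∷⁻ []       (there z∈) z≢x = z∈
  ∈-++-∷⁻ (_ ∷ xs) (here z≡)  z≢x = here z≡
  ∈-++-∷⁻ (_ ∷ xs) (there z∈) z≢x = there (∈-++-∷⁻ xs z∈ z≢x)

  -- A permutation, rather than a filter, lets sums over `zs` split at once into sums over `xs` and
  -- `ys`.
  complement : {xs zs : List A} → Unique xs → (∀ {z} → z ∈ xs → z ∈ zs) → ∃ λ ys → zs ↭ xs ++ ys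
  complement {[]}     {zs} _ _ = zs , ↭-refl
  complement {x ∷ xs} {zs} u xs⊆zs with ∈-∃++ (xs⊆zs (here refl))
  ... | as , bs , refl
    with ys , p ← complement {xs} {as ++ bs} (Unique-tail u)
           (λ z∈ → ∈-++-∷⁻ as (xs⊆zs (there z∈)) (λ { refl → Unique-∷⁻ u z∈ }))
    = ys , ↭-trans (shift x as bs) (prep x p)

  Unique-⊆⇒length≤ : {xs zs : List A} → Unique xs → (∀ {z} → z ∈ xs → z ∈ zs) → length xs ≤ length zs
  Unique-⊆⇒length≤ {xs} u xs⊆zs with ys , p ← complement u xs⊆zs
    rewrite ↭-length p | length-++ xs {ys} = m≤m+n _ _

  -- Levi's lemma, with the length bound selecting which factor is the longer one.
  ++-prefix : (as : List A) {bs cs ds : List A} → as ++ bs ≡ cs ++ ds → length as ≤ length cs →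
              ∃ λ es → cs ≡ as ++ es × bs ≡ es ++ ds
  ++-prefix []       {cs = cs} eq _ = cs , refl , eq
  ++-prefix (a ∷ as) {cs = c ∷ cs} eq (s≤s le) with ∷-injective eq
  ... | refl , eq′ with es , p , q ← ++-prefix as {cs = cs} eq′ le = es , cong (a ∷_) p , q

  last-satisfying : {P : A → Set} → Decidable P → (xs : List A) → Any P xs →
                    ∃ λ as → ∃ λ x → ∃ λ bs → xs ≡ as ++ x ∷ bs × P x × (∀ {z} → z ∈ bs → ¬ P z)
  last-satisfying P? (x ∷ xs) a with Any.any? P? xs
  ... | yes a′ with as , y , bs , refl , p , n ← last-satisfying P? xs a′ = x ∷ as , y , bs , refl , p , n
  last-satisfying P? (x ∷ xs) (here p)  | no ¬a = [] , x , xs , refl , p , λ z∈ q → ¬a (lose z∈ q)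
  last-satisfying P? (x ∷ xs) (there a) | no ¬a = ⊥-elim (¬a a)

-- Counting arcs by sums over lists.

⟦_⟧ : Bool → ℕ
⟦ true ⟧  = 1
⟦ false ⟧ = 0

⟦⟧≤1 : ∀ b → ⟦ b ⟧ ≤ 1
⟦⟧≤1 true  = ≤-refl
⟦⟧≤1 false = z≤n

⟦⟧+⟦⟧≤1 : ∀ a b → (a ≡ true → b ≡ true → ⊥) → ⟦ a ⟧ + ⟦ b ⟧ ≤ 1
⟦⟧+⟦⟧≤1 true  true  h = ⊥-elim (h refl refl)
⟦⟧+⟦⟧≤1 true  false h = ≤-refl
⟦⟧+⟦⟧≤1 false true  h = ≤-refl
⟦⟧+⟦⟧≤1 false false h = z≤n

2≤⟦⟧+⟦⟧ : ∀ {a b} → 2 ≤ ⟦ a ⟧ + ⟦ b ⟧ → a ≡ true × b ≡ true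
2≤⟦⟧+⟦⟧ {true}  {true}  _        = refl , refl
2≤⟦⟧+⟦⟧ {true}  {false} (s≤s ())
2≤⟦⟧+⟦⟧ {false} {true}  (s≤s ())
2≤⟦⟧+⟦⟧ {false} {false} ()

1≤⟦⟧+⟦⟧ : ∀ {a b} → 1 ≤ ⟦ a ⟧ + ⟦ b ⟧ → a ≡ true ⊎ b ≡ true
1≤⟦⟧+⟦⟧ {true}          _ = inj₁ refl
1≤⟦⟧+⟦⟧ {false} {true}  _ = inj₂ refl
1≤⟦⟧+⟦⟧ {false} {false} ()

0<⟦⟧ : ∀ {b} → 0 < ⟦ b ⟧ → b ≡ true
0<⟦⟧ {true} _ = refl

∑ : {A : Set} → (A → ℕ) → List A → ℕ
∑ f xs = sum (map f xs)

module _ {A : Set} where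

  ∑-++ : (f : A → ℕ) (xs ys : List A) → ∑ f (xs ++ ys) ≡ ∑ f xs + ∑ f ys
  ∑-++ f []       ys = refl
  ∑-++ f (x ∷ xs) ys = trans (cong (f x +_) (∑-++ f xs ys)) (sym (+-assoc (f x) _ _))

  ∑-↭ : (f : A → ℕ) {xs ys : List A} → xs ↭ ys → ∑ f xs ≡ ∑ f ys
  ∑-↭ f p = sum-↭ (↭-map⁺ f p)

  ∑-+ : (f g : A → ℕ) (xs : List A) → ∑ (λ x → f x + g x) xs ≡ ∑ f xs + ∑ g xs
  ∑-+ f g []       = refl
  ∑-+ f g (x ∷ xs) rewrite ∑-+ f g xs = interchange (f x) (g x) (∑ f xs) (∑ g xs)
    where
    interchange : ∀ a b c d → a + b + (c + d) ≡ a + c + (b + d)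
    interchange = solve-∀

  ∑-≤ : (f : A → ℕ) (c : ℕ) (xs : List A) → (∀ {x} → x ∈ xs → f x ≤ c) → ∑ f xs ≤ length xs * c
  ∑-≤ f c []       h = z≤n
  ∑-≤ f c (x ∷ xs) h = +-mono-≤ (h (here refl)) (∑-≤ f c xs (h ∘ there))

  ∑-≤1 : (f : A → ℕ) (xs : List A) → (∀ {x} → x ∈ xs → f x ≤ 1) → ∑ f xs ≤ length xs
  ∑-≤1 f []       h = z≤n
  ∑-≤1 f (x ∷ xs) h = +-mono-≤ (h (here refl)) (∑-≤1 f xs (h ∘ there))

  ∑-witness : (f : A → ℕ) (xs : List A) → 1 ≤ ∑ f xs → ∃ λ x → x ∈ xs × 0 < f x
  ∑-witness f (x ∷ xs) h with f x in eq
  ... | zero  with y , y∈ , p ← ∑-witness f xs h = y , there y∈ , p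
  ... | suc n = x , here refl , ≤-trans (s≤s z≤n) (≤-reflexive (sym eq))

  ∑-member : (f : A → ℕ) {xs : List A} {x : A} → x ∈ xs → f x ≤ ∑ f xs
  ∑-member f (here refl) = m≤m+n _ _
  ∑-member f (there x∈)  = ≤-trans (∑-member f x∈) (m≤n+m _ _)

  -- A single term below the maximum c would already pull the sum below `length xs * c`.
  ∑-extremal : (f : A → ℕ) (c : ℕ) (xs : List A) → (∀ x → f x ≤ c) → length xs * c ≤ ∑ f xs →
               ∀ {x} → x ∈ xs → c ≤ f x
  ∑-extremal f c (y ∷ ys) f≤c h (here refl) = by-contradiction-≤ λ fy<c →
    impossible 0 (+-mono-≤ (+-mono-≤ h fy<c) (∑-≤ f c ys (λ _ → f≤c _))) (arith c (length ys * c) (f y) (∑ f ys))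
    where
    arith : ∀ c n e s → c + n + suc e + s ≡ suc (e + s + c + n + 0)
    arith = solve-∀
  ∑-extremal f c (y ∷ ys) f≤c h (there x∈) = ∑-extremal f c ys f≤c
    (+-cancelˡ-≤ c _ _ (≤-trans h (+-mono-≤ (f≤c y) ≤-refl))) x∈

  ∑-atMostOne : (f : A → Bool) (xs : List A) → Unique xs →
                (∀ {x y} → x ∈ xs → y ∈ xs → f x ≡ true → f y ≡ true → x ≡ y) →
                ∑ (⟦_⟧ ∘ f) xs ≤ 1
  ∑-atMostOne f []       u h = z≤n
  ∑-atMostOne f (x ∷ xs) u h with f x in fx
  ... | false = ∑-atMostOne f xs (Unique-tail u) (λ p q → h (there p) (there q))
  ... | true  = s≤s (by-contradiction-≤ λ 0<∑ →
        case ∑-witness (⟦_⟧ ∘ f) xs 0<∑ of λ where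
          (y , y∈ , fy) → Unique-∷⁻ u (subst (_∈ xs) (sym (h (here refl) (there y∈) fx (0<⟦⟧ fy))) y∈))

∑-map : {A B : Set} (f : B → ℕ) (g : A → B) (xs : List A) → ∑ f (map g xs) ≡ ∑ (f ∘ g) xs
∑-map f g xs = cong sum (sym (map-∘ xs))

record Outside {n} (xs : List (Fin n)) : Set where
  field
    others        : List (Fin n)
    unique-others : Unique others
    others⇒∉      : ∀ {y} → y ∈ others → y ∉ xs
    ∉⇒others      : ∀ {y} → y ∉ xs → y ∈ others
    length-+      : length xs + length others ≡ n
    ∑-split       : ∀ f → ∑ f (allFin n) ≡ ∑ f xs + ∑ f others
open Outside

outside : ∀ {n} {xs : List (Fin n)} → Unique xs → Outside xs
outside {n} {xs} u with ys , p ← complement u (λ {z} _ → ∈-allFin z) = record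
  { others        = ys
  ; unique-others = Unique-++⁻ʳ xs u′
  ; others⇒∉      = Unique-++⁻-disjoint xs u′
  ; ∉⇒others      = λ {y} y∉ → case ∈-++⁻ xs (∈-resp-↭ p (∈-allFin y)) of λ where
                      (inj₁ q) → ⊥-elim (y∉ q)
                      (inj₂ q) → q
  ; length-+      = trans (sym (length-++ xs)) (trans (sym (↭-length p)) (length-tabulate _))
  ; ∑-split       = λ f → trans (∑-↭ f p) (∑-++ f xs ys)
  }
  where
  u′ = Unique-resp-↭ p (Unique.allFin⁺ n)

Unique⇒length≤ : ∀ {n} {xs : List (Fin n)} → Unique xs → length xs ≤ n
Unique⇒length≤ {n} u = ≤-trans (Unique-⊆⇒length≤ u (λ {z} _ → ∈-allFin z)) (≤-reflexive (length-tabulate _))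

-- Cycles as lists of pairs, and how they are rerouted.

Arcs : ℕ → Set
Arcs n = Fin n → Fin n → Bool

Pairs : ℕ → Set
Pairs n = List (Fin n × Fin n)

firsts seconds : ∀ {n} → Pairs n → List (Fin n)
firsts  = map proj₁
seconds = map proj₂

-- P holds the arcs from X to Y and Q those from Y to X, so that exchanging the two
-- sides is exchanging P and Q.  The pairs of a walk are its steps x → y from X to Y.
data Walk {n} (P Q : Arcs n) : Fin n → Pairs n → Fin n → Set where
  []   : ∀ {x} → Walk P Q x [] x
  hop : ∀ {x y x′ ps z} → P x y ≡ true → Q y x′ ≡ true → Walk P Q x′ ps z → Walk P Q x ((x , y) ∷ ps) z

-- The two sides are separate copies of `Fin n`, so distinctness is asked of each side alone. An
-- empty `ps` is accepted at every start; positivity is demanded where a genuine cycle is meant.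
record Cycle {n} (P Q : Arcs n) (ps : Pairs n) : Set where
  constructor cycle
  field
    {start}        : Fin n
    walk           : Walk P Q start ps start
    unique-firsts  : Unique (firsts ps)
    unique-seconds : Unique (seconds ps)
open Cycle

HasCycle : ∀ {n} → Arcs n → Arcs n → ℕ → Set
HasCycle P Q r = ∃ λ ps → length ps ≡ r × Cycle P Q ps

joins : ∀ {n} → Arcs n → Arcs n → Fin n → Fin n → ℕ
joins P Q x y = ⟦ P x y ⟧ + ⟦ Q y x ⟧

sends receives : ∀ {n} → Arcs n → Fin n → List (Fin n) → ℕ
sends    P v = ∑ (λ w → ⟦ P v w ⟧)
receives P v = ∑ (λ w → ⟦ P w v ⟧)

degree : ∀ {n} → Arcs n → Arcs n → Fin n → ℕ
degree {n} P Q x = ∑ (joins P Q x) (allFin n)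

-- Degree at least 2n - k, with k moved across to avoid truncated subtraction.
High : ∀ {n} → ℕ → Arcs n → Arcs n → Fin n → Set
High {n} k P Q x = 2 * n ≤ degree P Q x + k

joins≤2 : ∀ {n} (P Q : Arcs n) x y → joins P Q x y ≤ 2
joins≤2 P Q x y = ⟦⟧≤1 (P x y) ⊕ ⟦⟧≤1 (Q y x)

insert-↭ : {A : Set} (as : List A) {p q : A} {bs : List A} → as ++ p ∷ q ∷ bs ↭ q ∷ as ++ p ∷ bs
insert-↭ as {p} {q} {bs} =
  ↭-trans (↭-reflexive (sym (++-assoc as [ p ] (q ∷ bs))))
    (↭-trans (shift q (as ++ [ p ]) bs) (prep q (↭-reflexive (++-assoc as [ p ] bs))))

module _ {n : ℕ} {P Q : Arcs n} where

  infixr 5 _++ʷ_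
  _++ʷ_ : ∀ {x y z ps qs} → Walk P Q x ps y → Walk P Q y qs z → Walk P Q x (ps ++ qs) z
  []         ++ʷ w = w
  hop p q v ++ʷ w = hop p q (v ++ʷ w)

  split-walk : ∀ {x z} ps {qs} → Walk P Q x (ps ++ qs) z → ∃ λ y → Walk P Q x ps y × Walk P Q y qs z
  split-walk []       w = _ , [] , w
  split-walk (_ ∷ ps) (hop p q w) with y , u , v ← split-walk ps w = y , hop p q u , v

  rotate : ∀ as {bs} → Cycle P Q (as ++ bs) → Cycle P Q (bs ++ as)
  rotate as {bs} (cycle w u v) with _ , w₁ , w₂ ← split-walk as w =
    cycle (w₂ ++ʷ w₁) (Unique-resp-↭ (↭-map⁺ proj₁ (↭-++-comm as bs)) u)
                      (Unique-resp-↭ (↭-map⁺ proj₂ (↭-++-comm as bs)) v)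

  rotate-to : ∀ {ps x} → Cycle P Q ps → x ∈ firsts ps → ∃₂ λ y qs → Cycle P Q ((x , y) ∷ qs) × ps ↭ (x , y) ∷ qs
  rotate-to C x∈ with (x , y) , q∈ , refl ← ∈-map⁻ proj₁ x∈ with as , bs , refl ← ∈-∃++ q∈ =
    y , bs ++ as , rotate as C , ↭-++-comm as ((x , y) ∷ bs)

  module _ {as bs : Pairs n} {x y x″ z : Fin n}
           (u₁ : Unique (firsts (as ++ (x , y) ∷ bs))) (u₂ : Unique (seconds (as ++ (x , y) ∷ bs)))
           (w₁ : Walk P Q z as x) (Pxy : P x y ≡ true) (Qyx″ : Q y x″ ≡ true) (w₂ : Walk P Q x″ bs z) where

    -- The step x → y → x″ becomes x → y → v → w → x″.
    insert-after : ∀ {v w} → v ∉ firsts (as ++ (x , y) ∷ bs) → w ∉ seconds (as ++ (x , y) ∷ bs) →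
                   Q y v ≡ true → P v w ≡ true → Q w x″ ≡ true → Cycle P Q (as ++ (x , y) ∷ (v , w) ∷ bs)
    insert-after v∉ w∉ Qyv Pvw Qwx″ = cycle (w₁ ++ʷ hop Pxy Qyv (hop Pvw Qwx″ w₂))
      (Unique-resp-↭ (↭-sym (↭-map⁺ proj₁ (insert-↭ as))) (Unique-∷⁺ v∉ u₁))
      (Unique-resp-↭ (↭-sym (↭-map⁺ proj₂ (insert-↭ as))) (Unique-∷⁺ w∉ u₂))

    -- The step x → y becomes x → w → v → y, so the pair (x , y) is torn apart into (x , w) and (v ,
    -- y).
    insert-inside : ∀ {v w} → v ∉ firsts (as ++ (x , y) ∷ bs) → w ∉ seconds (as ++ (x , y) ∷ bs) →
                    P x w ≡ true → Q w v ≡ true → P v y ≡ true → Cycle P Q (as ++ (x , w) ∷ (v , y) ∷ bs)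
    insert-inside {v} {w} v∉ w∉ Pxw Qwv Pvy = cycle (w₁ ++ʷ hop Pxw Qwv (hop Pvy Qyx″ w₂))
      (Unique-resp-↭ (↭-trans (prep v (↭-reflexive same)) (↭-sym (↭-map⁺ proj₁ (insert-↭ as)))) (Unique-∷⁺ v∉ u₁))
      (Unique-resp-↭ (↭-sym (↭-trans (↭-map⁺ proj₂ (shift (x , w) as _)) (prep w (↭-reflexive same′)))) (Unique-∷⁺ w∉ u₂))
      where
      same : firsts (as ++ (x , y) ∷ bs) ≡ firsts (as ++ (x , w) ∷ bs)
      same = trans (map-++ proj₁ as _) (sym (map-++ proj₁ as _))
      same′ : seconds (as ++ (v , y) ∷ bs) ≡ seconds (as ++ (x , y) ∷ bs)
      same′ = trans (map-++ proj₂ as _) (sym (map-++ proj₂ as _))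

    replace-second : ∀ {w} → w ∉ seconds (as ++ (x , y) ∷ bs) → P x w ≡ true → Q w x″ ≡ true →
                     Cycle P Q (as ++ (x , w) ∷ bs) × y ∉ seconds (as ++ (x , w) ∷ bs)
    replace-second {w} w∉ Pxw Qwx″ =
        cycle (w₁ ++ʷ hop Pxw Qwx″ w₂) (subst Unique same u₁)
              (Unique-resp-↭ (↭-sym (shifted w)) (Unique-∷⁺ (λ w∈ → w∉ (∈-resp-↭ (↭-sym (shifted y)) (there w∈))) (Unique-tail u′)))
      , λ y∈ → case ∈-resp-↭ (shifted w) y∈ of λ where
          (here refl) → w∉ (∈-resp-↭ (↭-sym (shifted y)) (here refl))
          (there y∈′) → Unique-∷⁻ u′ y∈′
      where
      same : firsts (as ++ (x , y) ∷ bs) ≡ firsts (as ++ (x , w) ∷ bs)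
      same = trans (map-++ proj₁ as _) (sym (map-++ proj₁ as _))
      shifted : ∀ t → seconds (as ++ (x , t) ∷ bs) ↭ t ∷ seconds (as ++ bs)
      shifted t = ↭-map⁺ proj₂ (shift (x , t) as bs)
      u′ = Unique-resp-↭ (shifted y) u₂

  -- The place of the step and the walks around it are supplied, so that a violated bound can be
  -- answered by rerouting the cycle at that very step.
  Step-bound : (Fin n × Fin n → ℕ) → (Fin n → ℕ) → ℕ → Fin n → Pairs n → Fin n → Set
  Step-bound f g c x ps z = ∀ {as x′ y′ x″ bs} → ps ≡ as ++ (x′ , y′) ∷ bs →
    Walk P Q x as x′ → P x′ y′ ≡ true → Q y′ x″ ≡ true → Walk P Q x″ bs z → f (x′ , y′) + g x″ ≤ c

  -- The target of a step is the first vertex of the next one, so summing `g` over targets instead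
  -- of first vertices only trades g x for g z; on a cycle these cancel.
  walk-∑ : ∀ f g c {x ps z} → Walk P Q x ps z → Step-bound f g c x ps z →
           ∑ f ps + ∑ g (firsts ps) + g z ≤ length ps * c + g x
  walk-∑ f g c [] h = ≤-refl
  walk-∑ f g c {x} {(_ , y) ∷ ps} {z} (hop {x′ = x′} p q w) h = by-contradiction-≤ λ R<L →
    impossible 0 (+-mono-≤ (+-mono-≤ (h {as = []} refl [] p q w) ih) R<L)
      (arith (f (x , y)) (g x′) (∑ f ps) (∑ g (firsts ps)) (g z) c (length ps * c) (g x))
    where
    ih = walk-∑ f g c w λ eq w₁ → h (cong ((x , y) ∷_) eq) (hop p q w₁)
    arith : ∀ a b s t e c l d → a + b + (s + t + e) + suc (c + l + d) ≡ suc (c + (l + b) + (a + s + (d + t) + e) + 0)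
    arith = solve-∀

  cycle-∑ : ∀ f g c {ps} (C : Cycle P Q ps) → Step-bound f g c (start C) ps (start C) →
            ∑ f ps + ∑ g (firsts ps) ≤ length ps * c
  cycle-∑ f g c C h = +-cancelʳ-≤ (g (start C)) _ _ (walk-∑ f g c (walk C) h)

module _ {n : ℕ} {P Q : Arcs n} where

  -- Read from Y, each step joins the second half of one old step to the first half of the next; z →
  -- y₀ supplies the last half. The final clause identifies the new start, so that taking y₀ to be
  -- the first y closes the walk.
  flip-walk : ∀ {x ps z y₀} → Walk P Q x ps z → P z y₀ ≡ true →
    ∃ λ y → P x y ≡ true × ∃ λ qs → Walk Q P y qs y₀ × firsts qs ≡ seconds ps × x ∷ seconds qs ≡ firsts ps ++ [ z ]
          × (∀ {x′ y′ ps′} → ps ≡ (x′ , y′) ∷ ps′ → y ≡ y′)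
  flip-walk [] p = _ , p , [] , [] , refl , refl , λ ()
  flip-walk (hop {x} {y} p q w) p₀
    with y′ , p′ , qs , w′ , eq₁ , eq₂ , _ ← flip-walk w p₀ =
    y , p , (y , _) ∷ qs , hop q p′ w′ , cong (y ∷_) eq₁ , cong (x ∷_) eq₂ , λ { refl → refl }

  flip-cycle : ∀ {ps} → Cycle P Q ps → ∃ λ qs → Cycle Q P qs × firsts qs ≡ seconds ps × seconds qs ↭ firsts ps
  flip-cycle {[]}           C = [] , cycle {start = start C} [] [] [] , refl , ↭-refl
  flip-cycle {(x , y) ∷ ps} (cycle w@(hop p _ _) u₁ u₂)
    with y′ , p′ , qs , w′ , eq₁ , eq₂ , eq₃ ← flip-walk w p with refl ← eq₃ refl =
    qs , cycle w′ (subst Unique (sym eq₁) u₂) (Unique-resp-↭ (↭-sym perm) u₁) , eq₁ , perm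
    where
    perm : seconds qs ↭ firsts ((x , y) ∷ ps)
    perm = drop-∷ (↭-trans (↭-reflexive eq₂) (↭-++-comm (firsts ((x , y) ∷ ps)) [ x ]))

  flip-HasCycle : ∀ {r} → HasCycle P Q r → HasCycle Q P r
  flip-HasCycle (ps , len , C) with qs , C′ , eq , _ ← flip-cycle C =
    qs , trans (sym (length-map proj₁ qs)) (trans (cong length eq) (trans (length-map proj₂ ps) len)) , C′

-- Deciding whether a cycle of given length exists.

module _ {n : ℕ} where
  open DecUnique (Fin._≟_ {n}) using (unique?)

  any-pair? : {R : Fin n × Fin n → Set} → Decidable R → Dec (∃ R)
  any-pair? R? = map′ (λ { (x , y , r) → (x , y) , r }) (λ { ((x , y) , r) → x , y , r })
                      (Fin.any? λ x → Fin.any? λ y → R? (x , y))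

  any-pairs? : ∀ r {R : Pairs n → Set} → Decidable R → Dec (∃ λ ps → length ps ≡ r × R ps)
  any-pairs? zero    R? = map′ (λ r → [] , refl , r) (λ { ([] , _ , r) → r }) (R? [])
  any-pairs? (suc r) R? = map′ (λ { (p , ps , len , q) → p ∷ ps , cong suc len , q })
                               (λ { (p ∷ ps , len , q) → p , ps , suc-injective len , q })
                               (any-pair? λ p → any-pairs? r λ ps → R? (p ∷ ps))

  module _ (P Q : Arcs n) where

    walk? : ∀ x ps z → Dec (Walk P Q x ps z)
    walk? x []              z = map′ (λ { refl → [] }) (λ { [] → refl }) (x Fin.≟ z)
    walk? x ((x′ , y) ∷ ps) z =
      map′ (λ { (refl , p , _ , q , w) → hop p q w }) (λ { (hop p q w) → refl , p , _ , q , w })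
           (x Fin.≟ x′ ×-dec P x y Bool.≟ true ×-dec Fin.any? λ x″ → Q y x″ Bool.≟ true ×-dec walk? x″ ps z)

    cycle? : ∀ ps → Dec (Cycle P Q ps)
    cycle? ps = map′ (λ { ((_ , w) , u , v) → cycle w u v }) (λ { (cycle w u v) → (_ , w) , u , v })
                     ((Fin.any? λ x → walk? x ps x) ×-dec unique? (firsts ps) ×-dec unique? (seconds ps))

    -- Licenses assuming that a cycle cannot be enlarged and deriving a contradiction, through
    -- `decidable-stable`.
    hasCycle? : ∀ r → Dec (HasCycle P Q r)
    hasCycle? r = any-pairs? r cycle?

-- The degree conditions, and arcs between a stuck cycle and its outside.

-- The hypothesis in the form in which it is applied: the weaker bound has spread to all vertices,
-- so a dominated pair only has to report which of its members is high. The form is symmetric under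
-- exchange of the two sides.
record Conditions {n} (k : ℕ) (P Q : Arcs n) : Set where
  field
    1<k  : 1 < k
    2k≤n : 2 * k ≤ n
    minX : ∀ x → n + k ≤ degree P Q x
    minY : ∀ y → n + k ≤ degree Q P y
    domX : ∀ {y x x′} → x ≢ x′ → Q y x ≡ true → Q y x′ ≡ true → High k P Q x ⊎ High k P Q x′
    domY : ∀ {x y y′} → y ≢ y′ → P x y ≡ true → P x y′ ≡ true → High k Q P y ⊎ High k Q P y′

flip-conditions : ∀ {n k} {P Q : Arcs n} → Conditions k P Q → Conditions k Q P
flip-conditions H = record
  { 1<k = 1<k ; 2k≤n = 2k≤n ; minX = minY ; minY = minX ; domX = domY ; domY = domX }
  where open Conditions H

nonempty : {A : Set} (xs : List A) → 0 < length xs → ∃ (_∈ xs)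
nonempty (x ∷ _) _ = x , here refl

size-others : ∀ {A : Set} {n r} (f : A → Fin n) (ps : List A) → length ps ≡ r → (O : Outside (map f ps)) →
              r + length (others O) ≡ n
size-others f ps len O = trans (cong (_+ _) (sym (trans (length-map f ps) len))) (length-+ O)

degree-split : ∀ {n} (P Q : Arcs n) v {ys} (O : Outside ys) →
  degree P Q v ≡ sends P v ys + receives Q v ys + ∑ (joins P Q v) (others O)
degree-split P Q v {ys} O =
  trans (∑-split O (joins P Q v))
        (cong (_+ ∑ (joins P Q v) (others O)) (∑-+ (λ y → ⟦ P v y ⟧) (λ y → ⟦ Q y v ⟧) ys))

length-replace : {A : Set} (as : List A) {p q : A} {bs : List A} → length (as ++ p ∷ bs) ≡ length (as ++ q ∷ bs)
length-replace as = trans (length-++ as) (sym (length-++ as))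

length-insert : {A : Set} (as : List A) (p q p′ : A) {bs : List A} →
                length (as ++ p ∷ q ∷ bs) ≡ suc (length (as ++ p′ ∷ bs))
length-insert as _ _ _ {bs} =
  trans (length-++ as) (trans (+-suc (length as) (suc (length bs))) (cong suc (sym (length-++ as))))

module _ {n : ℕ} {P Q : Arcs n} {r : ℕ} {ps : Pairs n} (C : Cycle P Q ps) (len : length ps ≡ r) (stuck : ¬ HasCycle P Q (suc r))
         {v w} (v∉ : v ∉ firsts ps) (w∉ : w ∉ seconds ps) where

  -- At a step x′ → y′ → x″, arcs y′ → v and w → x″ would let v → w enter after y′; so each of the r
  -- steps offers at most one of them.
  no-insert-after : P v w ≡ true → receives Q v (seconds ps) + sends Q w (firsts ps) ≤ r
  no-insert-after Pvw rewrite ∑-map (λ y → ⟦ Q y v ⟧) proj₂ ps =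
    ≤-trans (cycle-∑ (λ p → ⟦ Q (proj₂ p) v ⟧) (λ x → ⟦ Q w x ⟧) 1 C
              λ { {as} {x′} {y′} {x″} refl w₁ p q w₂ → ⟦⟧+⟦⟧≤1 (Q y′ v) (Q w x″) λ e e′ →
                  stuck (_ , trans (length-insert as (x′ , y′) (v , w) (x′ , y′)) (cong suc len)
                       , insert-after {as = as} (unique-firsts C) (unique-seconds C) w₁ p q w₂ v∉ w∉ e Pvw e′) })
            (≤-reflexive (trans (*-identityʳ (length ps)) len))

  -- The detour x′ → w → v → y′ concerns the two vertices of one pair, so the weight on the next
  -- vertex is 0 in `cycle-∑`.
  no-insert-inside : Q w v ≡ true → receives P w (firsts ps) + sends P v (seconds ps) ≤ r
  no-insert-inside Qwv
    rewrite ∑-map (λ x → ⟦ P x w ⟧) proj₁ ps | ∑-map (λ y → ⟦ P v y ⟧) proj₂ ps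
          | sym (∑-+ (λ p → ⟦ P (proj₁ p) w ⟧) (λ p → ⟦ P v (proj₂ p) ⟧) ps) =
    ≤-trans (m≤m+n _ _) (≤-trans
      (cycle-∑ (λ p → ⟦ P (proj₁ p) w ⟧ + ⟦ P v (proj₂ p) ⟧) (λ _ → 0) 1 C
         λ { {as} {x′} {y′} refl w₁ p q w₂ → ≤-trans (≤-reflexive (+-identityʳ _))
             (⟦⟧+⟦⟧≤1 (P x′ w) (P v y′) λ e e′ →
               stuck (_ , trans (length-insert as (x′ , w) (v , y′) (x′ , y′)) (cong suc len)
                    , insert-inside {as = as} (unique-firsts C) (unique-seconds C) w₁ p q w₂ v∉ w∉ e Qwv e′)) })
      (≤-reflexive (trans (*-identityʳ (length ps)) len)))

  two-cycle-∑ : P v w ≡ true → Q w v ≡ true →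
    sends P v (seconds ps) + receives Q v (seconds ps) +
    (sends Q w (firsts ps) + receives P w (firsts ps)) ≤ 2 * r
  two-cycle-∑ Pvw Qwv = arith (sends P v (seconds ps)) (receives Q v (seconds ps)) (sends Q w (firsts ps)) (receives P w (firsts ps))
          (no-insert-after Pvw) (no-insert-inside Qwv)
    where
    arith : ∀ a b c d → b + c ≤ r → d + a ≤ r → a + b + (c + d) ≤ 2 * r
    arith a b c d h₁ h₂ = by-contradiction-≤ λ h →
      impossible 0 (h ⊕ h₁ ⊕ h₂) (solve (a & b & c & d & r & []))

  -- At most 2r arcs join v and w to the cycle, and each of the two has at most 2(n - r) arcs with
  -- the outside: 2r + 4(n - r) = 4n - 2r.
  two-cycle-degrees : P v w ≡ true → Q w v ≡ true → degree P Q v + degree Q P w + 2 * r ≤ 4 * n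
  two-cycle-degrees Pvw Qwv =
    add {degree P Q v} {degree Q P w} (sends P v (seconds ps) + receives Q v (seconds ps)) (sends Q w (firsts ps) + receives P w (firsts ps))
      (bound (sends P v (seconds ps) + receives Q v (seconds ps)) (length (others OY)) (degree-split P Q v OY)
        (∑-≤ (joins P Q v) 2 (others OY) (λ {y} _ → joins≤2 P Q v y)) (size-others proj₂ ps len OY))
      (bound (sends Q w (firsts ps) + receives P w (firsts ps)) (length (others OX)) (degree-split Q P w OX)
        (∑-≤ (joins Q P w) 2 (others OX) (λ {x} _ → joins≤2 Q P w x)) (size-others proj₁ ps len OX))
      (two-cycle-∑ Pvw Qwv)
    where
    OX = outside (unique-firsts C)
    OY = outside (unique-seconds C)
    bound : ∀ {d o} s m → d ≡ s + o → o ≤ m * 2 → r + m ≡ n → d + 2 * r ≤ s + 2 * n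
    bound {o = o} s m refl h e = by-contradiction-≤ λ lt →
      impossible 0 (lt ⊕ h ⊕ ≤-reflexive e ⊕ ≤-reflexive e) (solve (s & o & m & r & n & []))
    add : ∀ {d d′} s s′ → d + 2 * r ≤ s + 2 * n → d′ + 2 * r ≤ s′ + 2 * n → s + s′ ≤ 2 * r → d + d′ + 2 * r ≤ 4 * n
    add {d} {d′} s s′ h h′ h″ = by-contradiction-≤ λ lt →
      impossible 0 (lt ⊕ h ⊕ h′ ⊕ h″) (solve (d & d′ & s & s′ & r & n & []))

-- Enlarging a cycle when 2r > n.

module _ {n k : ℕ} {P Q : Arcs n} (H : Conditions k P Q) where
  open Conditions H

  -- A pair joined both ways outside a cycle with 2r > n has degree sum at most 4n − 2r < 3n,
  -- so it contains no high vertex.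
  no-high-two-cycle : ∀ {r ps} → Cycle P Q ps → length ps ≡ r → ¬ HasCycle P Q (suc r) → n < 2 * r →
    ∀ {u w} → High k P Q u → u ∉ firsts ps → w ∉ seconds ps → P u w ≡ true → Q w u ≡ true → ⊥
  no-high-two-cycle {r} C len stuck n<2r {u} {w} hu u∉ w∉ p q =
    arith n<2r hu (minY w) (two-cycle-degrees C len stuck u∉ w∉ p q)
    where
    arith : ∀ {du dw} → n < 2 * r → 2 * n ≤ du + k → n + k ≤ dw → du + dw + 2 * r ≤ 4 * n → ⊥
    arith {du} {dw} h₁ h₂ h₃ h₄ =
      impossible 0 (h₁ ⊕ h₂ ⊕ h₃ ⊕ h₄) (solve (du & dw & r & n & k & []))

  -- With u high and w both outside, each step x → y → x″ of a cycle that cannot be enlarged misses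
  -- one of x → w, u → y, y → u, w → x″: otherwise w may replace y, leaving u and y outside.
  grow-high : ∀ {r ps} → Cycle P Q ps → length ps ≡ r → n < 2 * r → ∀ {u} → u ∉ firsts ps → High k P Q u →
              HasCycle P Q (suc r)
  grow-high {r} {ps} C len n<2r {u} u∉ hu = decidable-stable (hasCycle? P Q (suc r)) λ stuck →
    let OX = outside (unique-firsts C)
        OY = outside (unique-seconds C)
        r+bX = size-others proj₁ ps len OX
        r+bY = size-others proj₂ ps len OY
        w , w∈ = nonempty (others OY) (OX-size (∉⇒others OX u∉) r+bX r+bY)
        w∉ = others⇒∉ OY w∈
        f = λ p → ⟦ P (proj₁ p) w ⟧ + joins P Q u (proj₂ p)
        ∑f : ∑ f ps ≡ receives P w (firsts ps) + (sends P u (seconds ps) + receives Q u (seconds ps))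
        ∑f = trans (∑-+ (λ p → ⟦ P (proj₁ p) w ⟧) (λ p → joins P Q u (proj₂ p)) ps)
               (cong₂ _+_ (sym (∑-map (λ x → ⟦ P x w ⟧) proj₁ ps))
                 (trans (sym (∑-map (joins P Q u) proj₂ ps)) (∑-+ (λ y → ⟦ P u y ⟧) (λ y → ⟦ Q y u ⟧) (seconds ps))))
        around : ∑ f ps + sends Q w (firsts ps) ≤ r * 3
        around = ≤-trans (cycle-∑ f (λ x → ⟦ Q w x ⟧) 3 C
          λ { {as} {x} {y} {x″} refl w₁ p q w₂ → four≤3 {P x w} {P u y} {Q y u} {Q w x″} λ e₁ e₂ e₃ e₄ →
              let C′ , y∉ = replace-second (unique-firsts C) (unique-seconds C) w₁ p q w₂ w∉ e₁ e₄
              in no-high-two-cycle C′ (trans (length-replace as) len) stuck n<2r hu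
                   (λ u∈ → u∉ (subst (u ∈_) (trans (map-++ proj₁ as _) (sym (map-++ proj₁ as _))) u∈)) y∉ e₂ e₃ })
          (≤-reflexive (cong (_* 3) len))
        outside-u : ∑ (joins P Q u) (others OY) ≤ length (others OY)
        outside-u = ∑-≤1 (joins P Q u) (others OY) λ {y} y∈ → ⟦⟧+⟦⟧≤1 (P u y) (Q y u) λ e₁ e₂ →
          no-high-two-cycle C len stuck n<2r hu u∉ (others⇒∉ OY y∈) e₁ e₂
        -- If no arc were missing between w and the outside of X, then w would be joined both ways
        -- to u.
        outside-w : ∑ (joins Q P w) (others OX) < length (others OX) * 2
        outside-w = by-contradiction-≤ λ h → no-high-two-cycle C len stuck n<2r hu u∉ w∉
          (proj₂ (both h (∉⇒others OX u∉))) (proj₁ (both h (∉⇒others OX u∉)))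
        a = sends P u (seconds ps)
        b = receives Q u (seconds ps)
        c = sends Q w (firsts ps)
        d = receives P w (firsts ps)
    -- With the cycle, u has at least (2n - k) - (n - r) arcs and w more than (n + k) - 2(n - r);
    -- together more than the 3r allowed by `around`.
    in contradictory (a + b) (c + d) (around-≤ a b c d ∑f around)
         (bound-u (a + b) (length (others OY)) (degree-split P Q u OY) hu outside-u r+bY)
         (bound-w (c + d) (length (others OX)) (degree-split Q P w OX) (minY w) outside-w r+bX)
    where
    OX-size : ∀ {r m} {xs : List (Fin n)} {x} → x ∈ xs → r + length xs ≡ n → r + m ≡ n → 0 < m
    OX-size {r} {m} {_ ∷ xs} _ e e′ = by-contradiction-≤ λ h →
      size (length xs) h (≤-reflexive (trans e (sym e′)))
      where
      size : ∀ l → m < 1 → r + suc l ≤ r + m → ⊥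
      size l h h′ = impossible l (h ⊕ h′) (solve (r & l & m & []))
    both : ∀ {w} {xs : List (Fin n)} → length xs * 2 < suc (∑ (joins Q P w) xs) → ∀ {x} → x ∈ xs → Q w x ≡ true × P x w ≡ true
    both {w} {xs} (s≤s h) x∈ = 2≤⟦⟧+⟦⟧ (∑-extremal (joins Q P w) 2 xs (joins≤2 Q P w) h x∈)
    four≤3 : ∀ {a b c d} → (a ≡ true → b ≡ true → c ≡ true → d ≡ true → ⊥) → ⟦ a ⟧ + (⟦ b ⟧ + ⟦ c ⟧) + ⟦ d ⟧ ≤ 3
    four≤3 {true}  {true}  {true}  {true}  h = ⊥-elim (h refl refl refl refl)
    four≤3 {true}  {true}  {true}  {false} h = ≤-refl
    four≤3 {true}  {true}  {false} {d}     h = ≤-refl ⊕ ⟦⟧≤1 d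
    four≤3 {true}  {false} {c}     {d}     h = (≤-refl {1} ⊕ ⟦⟧≤1 c) ⊕ ⟦⟧≤1 d
    four≤3 {false} {b}     {c}     {d}     h = (⟦⟧≤1 b ⊕ ⟦⟧≤1 c) ⊕ ⟦⟧≤1 d
    bound-u : ∀ {d o} s m → d ≡ s + o → 2 * n ≤ d + k → o ≤ m → r + m ≡ n → n + r ≤ s + k
    bound-u {o = o} s m refl h h′ e = by-contradiction-≤ λ lt →
      impossible 0 (lt ⊕ h ⊕ h′ ⊕ ≤-reflexive e) (solve (s & o & m & r & n & k & []))
    bound-w : ∀ {d o} s m → d ≡ s + o → n + k ≤ d → o < m * 2 → r + m ≡ n → k + 2 * r < s + n
    bound-w {o = o} s m refl h h′ e = by-contradiction-≤ λ lt →
      impossible 0 (lt ⊕ h ⊕ h′ ⊕ ≤-reflexive e ⊕ ≤-reflexive e) (solve (s & o & m & r & n & k & []))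
    around-≤ : ∀ a b c d {s} → s ≡ d + (a + b) → s + c ≤ r * 3 → a + b + (c + d) ≤ r * 3
    around-≤ a b c d refl = ≤-trans (≤-reflexive (regroup a b c d))
      where
      regroup : ∀ a b c d → a + b + (c + d) ≡ d + (a + b) + c
      regroup = solve-∀
    contradictory : ∀ s s′ → s + s′ ≤ r * 3 → n + r ≤ s + k → k + 2 * r < s′ + n → ⊥
    contradictory s s′ h h′ h″ = impossible 0 (h ⊕ h′ ⊕ h″) (solve (s & s′ & r & n & k & []))

module _ {n k : ℕ} {P Q : Arcs n} (H : Conditions k P Q) where
  open Conditions H

  grow-high′ : ∀ {r ps} → Cycle P Q ps → length ps ≡ r → n < 2 * r → ∀ {w} → w ∉ seconds ps → High k Q P w →
               HasCycle P Q (suc r)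
  grow-high′ {r} {ps} C len n<2r w∉ hw with qs , C′ , eq , _ ← flip-cycle C =
    flip-HasCycle (grow-high (flip-conditions H) C′
      (trans (sym (length-map proj₁ qs)) (trans (cong length eq) (trans (length-map proj₂ ps) len)))
      n<2r (subst (_ ∉_) (sym eq) w∉) hw)

  -- If no vertex of X outside is high, then w in Y outside dominates at most one of them, hence has enough
  -- arcs to and from the cycle to replace some y; as x → w and x → y, one of w and y is high.
  grow : ∀ {r ps} → Cycle P Q ps → length ps ≡ r → n < 2 * r → r < n → HasCycle P Q (suc r)
  grow {r} {ps} C len n<2r r<n with Any.any? (λ x → 2 * n ≤? degree P Q x + k) (others (outside (unique-firsts C)))
  ... | yes a with u , u∈ , hu ← find a = grow-high H C len n<2r (others⇒∉ (outside (unique-firsts C)) u∈) hu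
  ... | no none = decidable-stable (hasCycle? P Q (suc r)) λ stuck →
    let OX = outside (unique-firsts C)
        OY = outside (unique-seconds C)
        w , w∈ = nonempty (others OY) (positive (size-others proj₂ ps len OY))
        w∉ = others⇒∉ OY w∈
        one : sends Q w (others OX) ≤ 1
        one = ∑-atMostOne (Q w) (others OX) (unique-others OX) λ {x} {x′} x∈ x′∈ e e′ →
          decidable-stable (x Fin.≟ x′) λ x≢x′ → none (case domX x≢x′ e e′ of λ where
            (inj₁ h) → lose x∈ h
            (inj₂ h) → lose x′∈ h)
        around : receives P w (firsts ps) + sends Q w (firsts ps) ≤ length ps * 1
        around = subst (λ z → z + sends Q w (firsts ps) ≤ length ps * 1) (sym (∑-map (λ x → ⟦ P x w ⟧) proj₁ ps))
          (cycle-∑ (λ p → ⟦ P (proj₁ p) w ⟧) (λ x → ⟦ Q w x ⟧) 1 C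
            λ { {as} {x} {y} {x″} refl w₁ p q w₂ → ⟦⟧+⟦⟧≤1 (P x w) (Q w x″) λ e e′ →
              let C′ , y∉ = replace-second (unique-firsts C) (unique-seconds C) w₁ p q w₂ w∉ e e′
              in stuck (case domY (λ w≡y → w∉ (subst (_∈ _) (sym w≡y) (∈-map⁺ proj₂ (∈-insert as)))) e p of λ where
                   (inj₁ hw) → grow-high′ C len n<2r w∉ hw
                   (inj₂ hy) → grow-high′ C′ (trans (length-replace as) len) n<2r y∉ hy) })
    -- The degree of w is at most 1 + (n - r) + r = n + 1, which is less than n + k.
    in arith (sends Q w (firsts ps)) (receives P w (firsts ps)) (sends Q w (others OX)) (receives P w (others OX))
         (degree-split Q P w OX) (∑-+ (λ x → ⟦ Q w x ⟧) (λ x → ⟦ P x w ⟧) (others OX)) (minY w) one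
         (∑-≤1 (λ x → ⟦ P x w ⟧) (others OX) (λ {x} _ → ⟦⟧≤1 (P x w)))
         (size-others proj₁ ps len OX) (≤-trans around (≤-reflexive (trans (*-identityʳ (length ps)) len))) 1<k
    where
    positive : ∀ {m} → r + m ≡ n → 0 < m
    positive {m} e = by-contradiction-≤ λ h → impossible 0 (h ⊕ r<n ⊕ ≤-reflexive (sym e)) (solve (r & m & n & []))
    arith : ∀ {dw o m} a b c d → dw ≡ a + b + o → o ≡ c + d → n + k ≤ dw → c ≤ 1 → d ≤ m → r + m ≡ n →
            b + a ≤ r → 1 < k → ⊥
    arith {m = m} a b c d refl refl h₁ h₂ h₃ e h₄ h₅ =
      impossible 0 (≤-trans h₁ (≤-refl {a + b} ⊕ h₂ ⊕ h₃) ⊕ ≤-reflexive e ⊕ h₄ ⊕ h₅) (solve (a & b & m & r & n & k & []))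

-- Windows of a cycle, and cycles closed through one vertex.

module _ {A : Set} where

  -- Entry i of `as` is matched with entry i of `ds`, which stands `length cs` places further along
  -- the common list; each match contributes at most 1.
  window-∑ : (f g : A → ℕ) (as bs cs ds : List A) → as ++ bs ≡ cs ++ ds → length as ≡ length ds →
    (∀ es q us vs q′ ws → as ++ bs ≡ es ++ q ∷ us → q ∷ us ≡ vs ++ q′ ∷ ws → length vs ≡ length cs → f q + g q′ ≤ 1) →
    ∑ f as + ∑ g ds ≤ length as
  window-∑ f g [] bs cs [] eq len h = z≤n
  window-∑ f g (a ∷ as) bs cs (d ∷ ds) eq len h = by-contradiction-≤ λ lt →
    impossible 0 (lt ⊕ h [] a (as ++ bs) cs d ds refl eq refl ⊕ ih cs eq refl) (arith (f a) (g d) (∑ f as) (∑ g ds) (length as))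
    where
    arith : ∀ a b s t l → suc (suc l) + (a + b + (s + t)) ≡ suc (a + s + (b + t) + (1 + l) + 0)
    arith = solve-∀
    ih : ∀ cs′ → a ∷ as ++ bs ≡ cs′ ++ d ∷ ds → length cs′ ≡ length cs → ∑ f as + ∑ g ds ≤ length as
    ih [] eq′ len′ = window-∑ f g as bs [] ds (proj₂ (∷-injective eq′)) (suc-injective len)
      λ es q us vs q′ ws p p′ l → h (a ∷ es) q us vs q′ ws (cong (a ∷_) p) p′ (trans l len′)
    ih (c ∷ cs′) eq′ len′ = window-∑ f g as bs (cs′ ++ [ d ]) ds
      (trans (proj₂ (∷-injective eq′)) (sym (++-assoc cs′ [ d ] ds))) (suc-injective len)
      λ es q us vs q′ ws p p′ l → h (a ∷ es) q us vs q′ ws (cong (a ∷_) p) p′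
        (trans l (trans (trans (length-++ cs′) (+-comm _ 1)) len′))

split-at : {A : Set} (m : ℕ) (xs : List A) → m ≤ length xs → ∃₂ λ cs ds → xs ≡ cs ++ ds × length cs ≡ m
split-at zero    xs       _        = [] , xs , refl , refl
split-at (suc m) (x ∷ xs) (s≤s le) with cs , ds , eq , len ← split-at m xs le = x ∷ cs , ds , cong (x ∷_) eq , cong suc len

window-head : {A : Set} {q q′ : A} {us ws : List A} (vs : List A) → q ∷ us ≡ vs ++ q′ ∷ ws → ∃ λ R → q ∷ R ≡ vs ++ [ q′ ]
window-head []       refl = [] , refl
window-head (v ∷ vs) refl = vs ++ [ _ ] , refl

onto : ∀ {n} {xs : List (Fin n)} → Unique xs → length xs ≡ n → ∀ x → x ∈ xs
onto {xs = xs} u len x = decidable-stable (Any.any? (x Fin.≟_) xs) λ x∉ →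
  let O = outside u in absurd (others O) (∉⇒others O x∉) (trans (cong (_+ length (others O)) (sym len)) (length-+ O))
  where
  absurd : ∀ {n} (ys : List (Fin n)) {y} → y ∈ ys → n + length ys ≡ n → ⊥
  absurd {n} (_ ∷ ys) _ e = impossible (length ys) (≤-reflexive e) (+-suc n (length ys))

module _ {n : ℕ} {P Q : Arcs n} where

  rehead : ∀ {x x₀ a y R z} → Walk P Q x₀ ((a , y) ∷ R) z → P x y ≡ true → Walk P Q x ((x , y) ∷ R) z
  rehead (hop _ q w) p = hop p q w

  redirect : ∀ {x z z′ x₁ y₁} ps → Walk P Q x (ps ++ [ (x₁ , y₁) ]) z → Q y₁ z′ ≡ true →
             Walk P Q x (ps ++ [ (x₁ , y₁) ]) z′
  redirect []       (hop p _ []) q = hop p q []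
  redirect (_ ∷ ps) (hop p r w)  q = hop p r (redirect ps w q)

  -- x takes the place of the first vertex of the window from q to q′: it enters at the second entry
  -- of q and is re-entered from that of q′. With `vs` empty, q and q′ coincide and a 2-cycle
  -- results.
  shortcut : ∀ {x x₀ z q q′ R} vs → Walk P Q x₀ (vs ++ [ q′ ]) z → q ∷ R ≡ vs ++ [ q′ ] →
             Unique (firsts (vs ++ [ q′ ])) → Unique (seconds (vs ++ [ q′ ])) → x ∉ firsts R →
             P x (proj₂ q) ≡ true → Q (proj₂ q′) x ≡ true → HasCycle P Q (suc (length vs))
  shortcut {x} {x₀} {z} {q} {q′} {R} vs w eq u v x∉ Pxy Qyx =
      (x , proj₂ q) ∷ R
    , trans (cong length eq) (trans (length-++ vs) (+-comm _ 1))
    , cycle (rehead (subst (λ t → Walk P Q x₀ t x) (sym eq) (redirect vs w Qyx)) Pxy)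
            (Unique-∷⁺ x∉ (Unique-tail (subst (Unique ∘ firsts) (sym eq) u)))
            (subst (Unique ∘ seconds) (sym eq) v)

  chord cochord : Fin n → Fin n × Fin n → ℕ
  chord   x q = ⟦ P x (proj₂ q) ⟧
  cochord x q = ⟦ Q (proj₂ q) x ⟧

  -- By counting, x → yᵢ and yᵢ₊ₚ → x for some i, the indices being cyclic.
  below : ∀ {ps} → Cycle P Q ps → ∀ {x} → x ∉ firsts ps →
          length ps < sends P x (seconds ps) + receives Q x (seconds ps) → ∀ p → p < length ps → HasCycle P Q (suc p)
  below {ps} C {x} x∉ big p p<r with cs , ds , eq , lc ← split-at p ps (<⇒≤ p<r) =
    decidable-stable (hasCycle? P Q (suc p)) λ no →
      <⇒≱ big (subst (_≤ length ps) (cong₂ _+_ ∑f (∑g cs ds eq))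
        -- Appending the first p pairs once more turns cyclic windows into ordinary ones.
        (window-∑ (chord x) (cochord x) ps cs cs (ds ++ cs)
          (trans (cong (_++ cs) eq) (++-assoc cs ds cs))
          (trans (cong length eq) (↭-length (↭-++-comm cs ds)))
          λ es q us vs q′ ws e e′ len → ⟦⟧+⟦⟧≤1 (P x (proj₂ q)) (Q (proj₂ q′) x) λ Pxy Qyx →
            -- q lies in the first turn, so rotating the cycle by `es` makes its window a prefix
            -- even if it wraps round.
            let gs , ps≡ , qus≡ = ++-prefix es (sym e) (es-short cs es (q ∷ us) vs (q′ ∷ ws) (cong length e) (cong length e′) len)
                W = vs ++ [ q′ ]
                hs , rot≡ , _ = ++-prefix W {ws ++ ds} {gs ++ es} {gs}
                  (trans (trans (++-assoc vs [ q′ ] (ws ++ ds)) (trans (sym (++-assoc vs (q′ ∷ ws) ds)) (cong (_++ ds) (sym e′))))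
                    (trans (cong (_++ ds) qus≡) (trans (++-assoc gs cs ds)
                      (trans (cong (gs ++_) (trans (sym eq) ps≡)) (sym (++-assoc gs es gs))))))
                  (W-short vs q′ (trans len lc) (trans (cong length ps≡) (↭-length (↭-++-comm es gs))))
                C′ = subst (Cycle P Q) rot≡ (rotate es (subst (Cycle P Q) ps≡ C))
                R , eqR = window-head vs e′
                _ , w , _ = split-walk W (walk C′)
            in no (subst (HasCycle P Q ∘ suc) (trans len lc)
                 (shortcut vs w eqR
                   (Unique-++⁻ˡ (firsts W) (subst Unique (map-++ proj₁ W hs) (unique-firsts C′)))
                   (Unique-++⁻ˡ (seconds W) (subst Unique (map-++ proj₂ W hs) (unique-seconds C′)))
                   (λ x∈ → x∉ (subst (λ t → x ∈ firsts t) (sym ps≡)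
                      (∈-resp-↭ (↭-map⁺ proj₁ (↭-++-comm gs es)) (subst (λ t → x ∈ firsts t) (sym rot≡)
                        (subst (x ∈_) (sym (map-++ proj₁ W hs)) (∈-++⁺ˡ (subst (λ t → x ∈ firsts t) eqR (there x∈))))))))
                   Pxy Qyx))))
    where
    ∑f : ∑ (chord x) ps ≡ sends P x (seconds ps)
    ∑f = sym (∑-map (λ y → ⟦ P x y ⟧) proj₂ ps)
    ∑g : ∀ cs ds → ps ≡ cs ++ ds → ∑ (cochord x) (ds ++ cs) ≡ receives Q x (seconds ps)
    ∑g cs ds eq = trans (∑-↭ (cochord x) (↭-trans (↭-++-comm ds cs) (↭-reflexive (sym eq)))) (sym (∑-map (λ y → ⟦ Q y x ⟧) proj₂ ps))
    es-short : ∀ (cs es us vs ws : Pairs n) → length (ps ++ cs) ≡ length (es ++ us) → length us ≡ length (vs ++ ws) →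
               length vs ≡ length cs → length es ≤ length ps
    es-short cs es us vs ws e e′ len rewrite length-++ ps {cs} | length-++ es {us} | e′ | length-++ vs {ws} | len =
      arith (length es) (length cs) (length ps) (length ws) e
      where
      arith : ∀ a b c d → c + b ≡ a + (b + d) → a ≤ c
      arith a b c d e = by-contradiction-≤ λ lt → impossible d (lt ⊕ ≤-reflexive (sym e)) (solve (a & b & c & d & []))
    W-short : ∀ (vs : Pairs n) q {l} → length vs ≡ p → length ps ≡ l → length (vs ++ [ q ]) ≤ l
    W-short vs q len refl rewrite length-++ vs {[ q ]} | len | +-comm p 1 = p<r

  module _ {A : Set} (f : Fin n × Fin n → A) where

    Unique-infix : ∀ es W ws {ps} → ps ≡ es ++ W ++ ws → Unique (map f ps) → Unique (map f W)
    Unique-infix es W ws refl u = Unique-++⁻ˡ (map f W) {map f ws} (subst Unique (map-++ f W ws)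
      (Unique-++⁻ʳ (map f es) (subst Unique (map-++ f es (W ++ ws)) u)))

    head∉ : ∀ es {q₀ rest q} R ws → q₀ ∷ rest ≡ es ++ q ∷ R ++ ws → Unique (map f (q₀ ∷ rest)) → f q₀ ∉ map f R
    head∉ []       R ws refl u q∈ = Unique-∷⁻ u (subst (_ ∈_) (sym (map-++ f R ws)) (∈-++⁺ˡ q∈))
    head∉ (e ∷ es) {q = q} R ws refl u q∈ = Unique-∷⁻ u (subst (_ ∈_) (sym (map-++ f es (q ∷ R ++ ws)))
      (∈-++⁺ʳ (map f es) (there (subst (_ ∈_) (sym (map-++ f R ws)) (∈-++⁺ˡ q∈)))))

  -- The cycle starts at x, so a window that does not wrap round contains x at most as its first
  -- vertex, which is the one being replaced. There are k + 1 windows of n - k pairs, each allowing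
  -- one of its two arcs; the arcs not covered are n - k - 1 out of x and n - k - 1 into x. The
  -- degree of x would be at most 2n - k - 1.
  below-spanning-from : ∀ {k x y₀ qs p} → Cycle P Q ((x , y₀) ∷ qs) → length ((x , y₀) ∷ qs) ≡ n →
                        High k P Q x → suc p + k ≡ n → HasCycle P Q (suc p)
  below-spanning-from {k} {x} {y₀} {qs} {p} C len hx pk
    with as , bs , eq′ , la ← split-at (suc k) ((x , y₀) ∷ qs) (≤-trans (m≤n+m (suc k) p) (≤-reflexive (trans (+-suc p k) (trans pk (sym len)))))
    with cs , ds , eq , lc ← split-at p ((x , y₀) ∷ qs) (≤-trans (m≤m+n p (suc k)) (≤-reflexive (trans (+-suc p k) (trans pk (sym len))))) =
    decidable-stable (hasCycle? P Q (suc p)) λ no →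
      let O = outside (unique-seconds C)
          lds = trans (sym (length-++ cs)) (trans (cong length (sym eq)) len)
          lbs = trans (sym (length-++ as)) (trans (cong length (sym eq′)) len)
          h = window-∑ (chord x) (cochord x) as bs cs ds (trans (sym eq′) eq)
            (trans la (+-cancelˡ-≡ p (suc k) (length ds) (trans (+-suc p k) (trans pk (trans (sym lds) (cong (_+ length ds) lc))))))
            λ es q us vs q′ ws e e′ lv → ⟦⟧+⟦⟧≤1 (P x (proj₂ q)) (Q (proj₂ q′) x) λ Pxy Qyx →
              let W = vs ++ [ q′ ]
                  eqW : ps ≡ es ++ W ++ ws
                  eqW = trans eq′ (trans e (cong (es ++_) (trans e′ (sym (++-assoc vs [ q′ ] ws)))))
                  R , eqR = window-head vs e′
                  _ , _ , w₂ = split-walk es (subst (λ t → Walk P Q (start C) t (start C)) eqW (walk C))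
                  _ , w , _ = split-walk W w₂
              in no (subst (HasCycle P Q ∘ suc) (trans lv lc)
                   (shortcut vs w eqR (Unique-infix proj₁ es W ws eqW (unique-firsts C)) (Unique-infix proj₂ es W ws eqW (unique-seconds C))
                     (head∉ proj₁ es R ws (trans eqW (cong (λ t → es ++ t ++ ws) (sym eqR))) (unique-firsts C)) Pxy Qyx))
      in arith (∑ (chord x) as) (∑ (chord x) bs) (∑ (cochord x) cs) (∑ (cochord x) ds)
           (degree-split P Q x O)
           (trans (∑-map (λ y → ⟦ P x y ⟧) proj₂ ps) (trans (cong (∑ (chord x)) eq′) (∑-++ (chord x) as bs)))
           (trans (∑-map (λ y → ⟦ Q y x ⟧) proj₂ ps) (trans (cong (∑ (cochord x)) eq) (∑-++ (cochord x) cs ds)))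
           (∑-≤ (joins P Q x) 2 (others O) (λ {y} _ → joins≤2 P Q x y)) (size-others proj₂ ps len O)
           hx h (∑-≤1 (chord x) bs (λ {q} _ → ⟦⟧≤1 (P x (proj₂ q)))) (∑-≤1 (cochord x) cs (λ {q} _ → ⟦⟧≤1 (Q (proj₂ q) x))) lc lbs pk
    where
    ps = (x , y₀) ∷ qs
    few : ∀ a b c e {la lb lc} → a + e ≤ la → b ≤ lb → c ≤ lc → a + b + (c + e) ≤ la + lb + lc
    few a b c e h₁ h₂ h₃ = ≤-trans (≤-reflexive (regroup a b c e)) ((h₁ ⊕ h₂) ⊕ h₃)
      where
      regroup : ∀ a b c e → a + b + (c + e) ≡ a + e + b + c
      regroup = solve-∀
    none-outside : ∀ l → n + l ≡ n → l ≡ 0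
    none-outside l e = +-cancelˡ-≡ n l 0 (trans e (sym (+-identityʳ n)))
    contradictory : ∀ {d lc} la lb → d ≤ la + lb + lc + 0 → 2 * n ≤ d + k → la + lb ≡ n → lc ≡ p → suc p + k ≡ n → ⊥
    contradictory {d} la lb h₁ h₂ refl refl e = impossible 0 (h₁ ⊕ h₂ ⊕ ≤-reflexive e) (solve (d & k & la & lb & p & []))
    arith : ∀ {d A B o l la lb lc} a b c e → d ≡ A + B + o → A ≡ a + b → B ≡ c + e → o ≤ l * 2 → n + l ≡ n → 2 * n ≤ d + k →
            a + e ≤ la → b ≤ lb → c ≤ lc → lc ≡ p → la + lb ≡ n → suc p + k ≡ n → ⊥
    arith {l = l} {la} {lb} a b c e refl refl refl h₁ e₁ h₂ h₃ h₄ h₅ e₂ e₃ e₄ =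
      contradictory la lb (few a b c e h₃ h₄ h₅ ⊕ ≤-trans h₁ (≤-reflexive (cong (_* 2) (none-outside l e₁)))) h₂ e₃ e₂ e₄

  below-spanning : ∀ {k ps} → Cycle P Q ps → length ps ≡ n → ∀ {x} → High k P Q x → ∀ {p} → suc p + k ≡ n → HasCycle P Q (suc p)
  below-spanning {k} {ps} C len {x} hx pk
    with y₀ , qs , C′ , perm ← rotate-to C (onto {xs = firsts ps} (unique-firsts C) (trans (length-map proj₁ ps) len) x) =
    below-spanning-from C′ (trans (sym (↭-length perm)) len) hx pk

-- The critical case 2r = n.

module _ {n : ℕ} {P Q : Arcs n} where

  fill : ∀ {us ws : List (Fin n)} → length us ≡ length ws →
         ∃ λ ps → firsts ps ≡ us × seconds ps ≡ ws
  fill {[]}     {[]}     _   = [] , refl , refl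
  fill {u ∷ us} {w ∷ ws} len with ps , e , e′ ← fill (suc-injective len) = (u , w) ∷ ps , cong (u ∷_) e , cong (w ∷_) e′

  complete-walk : ∀ {x w x′} ps → P x w ≡ true →
    (∀ {u v} → u ∈ x′ ∷ firsts ps → v ∈ w ∷ seconds ps → P u v ≡ true × Q v u ≡ true) →
    Walk P Q x ((x , w) ∷ ps) x′
  complete-walk []             Pxw both = hop Pxw (proj₂ (both (here refl) (here refl))) []
  complete-walk ((u , v) ∷ ps) Pxw both =
    hop Pxw (proj₂ (both (there (here refl)) (here refl)))
      (complete-walk ps (proj₁ (both (there (here refl)) (there (here refl)))) λ where
        (here refl) v∈ → both (here refl) (there v∈)
        (there u∈)  v∈ → both (there (there u∈)) (there v∈))

  -- The new cycle goes x → w, zigzags through the complete outside to x′, then takes x′ → y′ and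
  -- follows the old cycle back to x.
  detour : ∀ {x y qs x′ w y′ us ws} (C : Cycle P Q ((x , y) ∷ qs)) →
    Unique (x′ ∷ us) → Unique (w ∷ ws) → length us ≡ length ws → length qs ≤ length us →
    (∀ {u} → u ∈ x′ ∷ us → u ∉ firsts ((x , y) ∷ qs)) → (∀ {v} → v ∈ w ∷ ws → v ∉ seconds ((x , y) ∷ qs)) →
    (∀ {u v} → u ∈ x′ ∷ us → v ∈ w ∷ ws → P u v ≡ true × Q v u ≡ true) →
    P x w ≡ true → P x′ y′ ≡ true → y′ ∈ seconds qs → HasCycle P Q (suc (suc (length qs)))
  detour {x} {y} {qs} {x′} {w} {us = us} {ws} (cycle (hop p q walk₀) u₁ u₂) ux uw same enough x∉ w∉ both Pxw Px′y′ y′∈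
    with (xⱼ , y′) , q∈ , refl ← ∈-map⁻ proj₂ y′∈
    with bs , ds , refl ← ∈-∃++ q∈
    with zs , refl , refl ← fill {us} {ws} same
    -- The stretch from y to xⱼ that is bypassed has `length bs` + 1 vertices on each side. As many
    -- outside pairs, together with w and x′, make the cycle longer by exactly one pair.
    with fs , rest , refl , lf ← split-at (suc (length bs)) zs
           (≤-trans (≤-trans (s≤s (m≤m+n _ (length ds))) (≤-reflexive (trans (sym (+-suc (length bs) (length ds))) (sym (length-++ bs)))))
                    (≤-trans enough (≤-reflexive (length-map proj₁ zs)))) =
      ((x , w) ∷ fs) ++ (x′ , y′) ∷ ds
    , size
    , cycle (complete-walk fs Pxw (λ u∈ v∈ → both (widen proj₁ u∈) (widen proj₂ v∈)) ++ʷ rehead tail-walk Px′y′)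
        (subst Unique (sym (cong (x ∷_) (map-++ proj₁ fs _))) (Unique-resp-↭ (order (firsts fs))
          (Unique.++⁺ (narrow proj₁ x′ ux) (drop-middle proj₁ (x , y) u₁)
            λ (u∈ , u∈′) → x∉ (widen proj₁ u∈) (keep proj₁ (x , y) u∈′))))
        (subst Unique (sym (cong (w ∷_) (map-++ proj₂ fs _)))
          (Unique.++⁺ (narrow proj₂ w uw) (Unique-++⁻ʳ (seconds ((x , y) ∷ bs)) (subst Unique (map-++ proj₂ ((x , y) ∷ bs) _) u₂))
            λ {v} (v∈ , v∈′) → w∉ (widen proj₂ v∈) (subst (v ∈_) (sym (map-++ proj₂ ((x , y) ∷ bs) _)) (∈-++⁺ʳ (seconds ((x , y) ∷ bs)) v∈′))))
    where
    tail-walk : Walk P Q xⱼ ((xⱼ , y′) ∷ ds) x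
    tail-walk with _ , _ , hop p′ q′ w′ ← split-walk bs walk₀ = hop p′ q′ w′
    widen : (f : Fin n × Fin n → Fin n) → ∀ {a t} → t ∈ a ∷ map f fs → t ∈ a ∷ map f (fs ++ rest)
    widen f (here e)   = here e
    widen f (there t∈) = there (subst (_ ∈_) (sym (map-++ f fs rest)) (∈-++⁺ˡ t∈))
    narrow : (f : Fin n × Fin n → Fin n) → ∀ a → Unique (a ∷ map f (fs ++ rest)) → Unique (a ∷ map f fs)
    narrow f a u = Unique-++⁻ˡ (a ∷ map f fs) (subst Unique (cong (a ∷_) (map-++ f fs rest)) u)
    drop-middle : (f : Fin n × Fin n → Fin n) → ∀ a → Unique (map f (a ∷ bs ++ (xⱼ , y′) ∷ ds)) → Unique (map f (a ∷ ds))
    drop-middle f a u = Unique-∷⁺ (λ a∈ → Unique-∷⁻ u (subst (f a ∈_) (sym (map-++ f bs _)) (∈-++⁺ʳ (map f bs) (there a∈))))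
      (Unique-tail (Unique-++⁻ʳ (map f bs) (subst Unique (map-++ f bs _) (Unique-tail u))))
    keep : (f : Fin n × Fin n → Fin n) → ∀ a {t} → t ∈ map f (a ∷ ds) → t ∈ map f (a ∷ bs ++ (xⱼ , y′) ∷ ds)
    keep f a (here e)   = here e
    keep f a (there t∈) = there (subst (_ ∈_) (sym (map-++ f bs _)) (∈-++⁺ʳ (map f bs) (there t∈)))
    order : ∀ fs′ → (x′ ∷ fs′) ++ x ∷ firsts ds ↭ x ∷ fs′ ++ x′ ∷ firsts ds
    order fs′ = ↭-trans (shift x (x′ ∷ fs′) _) (prep x (↭-sym (shift x′ fs′ _)))
    size : length (((x , w) ∷ fs) ++ (x′ , y′) ∷ ds) ≡ suc (suc (length (bs ++ (xⱼ , y′) ∷ ds)))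
    size rewrite length-++ fs {(x′ , y′) ∷ ds} | lf | length-++ bs {(xⱼ , y′) ∷ ds} = refl

-- Strong connectivity gives a crossing arc in each direction but does not choose the side on which
-- it begins.
Enters Leaves : ∀ {n} → Arcs n → Arcs n → Pairs n → Set
Enters P Q ps = (∃₂ λ x w → x ∈ firsts ps × w ∉ seconds ps × P x w ≡ true) ⊎
                (∃₂ λ y x → y ∈ seconds ps × x ∉ firsts ps × Q y x ≡ true)
Leaves P Q ps = (∃₂ λ x y → x ∉ firsts ps × y ∈ seconds ps × P x y ≡ true) ⊎
                (∃₂ λ w x → w ∉ seconds ps × x ∈ firsts ps × Q w x ≡ true)

-- The critical case 2r = n: a cycle that cannot be enlarged has a complete outside.  Then every outside vertex
-- of Y is entered from the cycle and every outside vertex of X leaves to it, by strong connectivity.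
module _ {n k : ℕ} {P Q : Arcs n} (H : Conditions k P Q) {r ps} (C : Cycle P Q ps) (len : length ps ≡ r)
         (r≤k : r ≤ k) (2r≡n : 2 * r ≡ n) (stuck : ¬ HasCycle P Q (suc r)) where
  open Conditions H
  private
    OX = outside (unique-firsts C)
    OY = outside (unique-seconds C)
    bX = size-others proj₁ ps len OX
    bY = size-others proj₂ ps len OY

    sizeX : length (others OX) ≡ r
    sizeX = +-cancelˡ-≡ r _ _ (trans bX (trans (sym 2r≡n) (cong (r +_) (+-identityʳ r))))
    sizeY : length (others OY) ≡ r
    sizeY = +-cancelˡ-≡ r _ _ (trans bY (trans (sym 2r≡n) (cong (r +_) (+-identityʳ r))))

    -- From here on all degrees are measured in r: at least 3r in total, at most 2r with the
    -- outside.
    3r≤ : ∀ {d} → n + k ≤ d → 3 * r ≤ d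
    3r≤ {d} h = by-contradiction-≤ λ lt → impossible 0 (lt ⊕ h ⊕ r≤k ⊕ ≤-reflexive 2r≡n) (solve (d & r & n & k & []))

    0<r : 0 < r
    0<r = by-contradiction-≤ λ h → arith h
      where
      arith : r < 1 → ⊥
      arith h = impossible 3 (1<k ⊕ 2k≤n ⊕ 1<k ⊕ ≤-reflexive (sym 2r≡n) ⊕ h ⊕ h) (solve (r & n & k & []))

    at-least-r : ∀ {d o} s → d ≡ s + o → o ≤ r * 2 → 3 * r ≤ d → r ≤ s
    at-least-r {o = o} s refl h₁ h₂ = by-contradiction-≤ λ lt → impossible 0 (lt ⊕ h₁ ⊕ h₂) (solve (s & o & r & []))

    module _ {x} (x∈ : x ∈ others OX) where

      splitX : degree P Q x ≡ sends P x (seconds ps) + receives Q x (seconds ps) + ∑ (joins P Q x) (others OY)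
      splitX = degree-split P Q x OY

      outside-≤X : ∑ (joins P Q x) (others OY) ≤ r * 2
      outside-≤X = ≤-trans (∑-≤ (joins P Q x) 2 (others OY) (λ {y} _ → joins≤2 P Q x y)) (≤-reflexive (cong (_* 2) sizeY))

      cycle-≥X : r ≤ sends P x (seconds ps) + receives Q x (seconds ps)
      cycle-≥X = at-least-r (sends P x (seconds ps) + receives Q x (seconds ps)) splitX outside-≤X (3r≤ (minX x))

    module _ {w} (w∈ : w ∈ others OY) where

      splitY : degree Q P w ≡ sends Q w (firsts ps) + receives P w (firsts ps) + ∑ (joins Q P w) (others OX)
      splitY = degree-split Q P w OX

      outside-≤Y : ∑ (joins Q P w) (others OX) ≤ r * 2
      outside-≤Y = ≤-trans (∑-≤ (joins Q P w) 2 (others OX) (λ {x} _ → joins≤2 Q P w x)) (≤-reflexive (cong (_* 2) sizeX))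

      cycle-≥Y : r ≤ sends Q w (firsts ps) + receives P w (firsts ps)
      cycle-≥Y = at-least-r (sends Q w (firsts ps) + receives P w (firsts ps)) splitY outside-≤Y (3r≤ (minY w))

    module _ {x w} (x∈ : x ∈ others OX) (w∈ : w ∈ others OY) (Pxw : P x w ≡ true) (Qwx : Q w x ≡ true) where

      private
        twice = two-cycle-∑ C len stuck (others⇒∉ OX x∈) (others⇒∉ OY w∈) Pxw Qwx

        full : ∀ {d d′ o o′} s s′ → d ≡ s + o → d′ ≡ s′ + o′ → s + s′ ≤ 2 * r → 3 * r ≤ d → 3 * r ≤ d′ → o′ ≤ r * 2 → r * 2 ≤ o
        full {o = o} {o′} s s′ refl refl h h₁ h₂ h₃ = by-contradiction-≤ λ lt → impossible 0 (lt ⊕ h ⊕ h₁ ⊕ h₂ ⊕ h₃) (solve (s & s′ & o & o′ & r & []))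

      -- The degrees of x and w sum to at least 6r, of which at most 2r go to the cycle; so both
      -- must have all 2r possible arcs with the outside.
      all-Y : ∀ {w′} → w′ ∈ others OY → P x w′ ≡ true × Q w′ x ≡ true
      all-Y = 2≤⟦⟧+⟦⟧ ∘ ∑-extremal (joins P Q x) 2 (others OY) (joins≤2 P Q x)
        (≤-trans (≤-reflexive (cong (_* 2) sizeY))
          (full (sends P x (seconds ps) + receives Q x (seconds ps)) (sends Q w (firsts ps) + receives P w (firsts ps))
                (splitX x∈) (splitY w∈) twice (3r≤ (minX x)) (3r≤ (minY w)) (outside-≤Y w∈)))

      all-X : ∀ {x′} → x′ ∈ others OX → Q w x′ ≡ true × P x′ w ≡ true
      all-X = 2≤⟦⟧+⟦⟧ ∘ ∑-extremal (joins Q P w) 2 (others OX) (joins≤2 Q P w)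
        (≤-trans (≤-reflexive (cong (_* 2) sizeX))
          (full (sends Q w (firsts ps) + receives P w (firsts ps)) (sends P x (seconds ps) + receives Q x (seconds ps))
                (splitY w∈) (splitX x∈) (≤-trans (≤-reflexive (+-comm (sends Q w (firsts ps) + receives P w (firsts ps)) _)) twice)
                (3r≤ (minY w)) (3r≤ (minX x)) (outside-≤X x∈)))

    ≤r : ∀ (b : Fin n → Bool) {A : Set} (f : A → Fin n) (qs : List A) → length qs ≡ r → ∑ (⟦_⟧ ∘ b) (map f qs) ≤ r
    ≤r b f qs eq = ≤-trans (∑-≤1 (⟦_⟧ ∘ b) (map f qs) (λ {z} _ → ⟦⟧≤1 (b z))) (≤-reflexive (trans (length-map f qs) eq))

    some : ∀ {d o} a b → d ≡ a + b + o → 3 * r ≤ d → a ≤ r → b ≤ r → 1 ≤ o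
    some {o = o} a b refl h₁ h₂ h₃ = by-contradiction-≤ λ lt → impossible 0 (lt ⊕ h₁ ⊕ h₂ ⊕ h₃ ⊕ 0<r) (solve (a & b & o & r & []))

    -- Two degrees of at least 3r would be covered by five contributions of at most r each: a, e, b
    -- + c, o and o′.
    clash : ∀ {d d′ o o′} a b c e → d ≡ a + b + o → d′ ≡ c + e + o′ → 3 * r ≤ d → 3 * r ≤ d′ → o ≤ r → o′ ≤ r →
            b + c ≤ r → a ≤ r → e ≤ r → ⊥
    clash a b c e refl refl h₁ h₂ h₃ h₄ h₅ h₆ h₇ =
      impossible 0 (≤-trans h₁ ((h₆ ⊕ ≤-refl {b}) ⊕ h₃) ⊕ ≤-trans h₂ ((≤-refl {c} ⊕ h₇) ⊕ h₄) ⊕ h₅ ⊕ 0<r) (solve (b & c & r & []))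

    module _ (none : ∀ {x w} → x ∈ others OX → w ∈ others OY → P x w ≡ true → Q w x ≡ true → ⊥) where

      few-X : ∀ {x} → x ∈ others OX → ∑ (joins P Q x) (others OY) ≤ r
      few-X {x} x∈ = ≤-trans (∑-≤1 (joins P Q x) (others OY) (λ {w} w∈ → ⟦⟧+⟦⟧≤1 (P x w) (Q w x) (none x∈ w∈))) (≤-reflexive sizeY)

      few-Y : ∀ {w} → w ∈ others OY → ∑ (joins Q P w) (others OX) ≤ r
      few-Y {w} w∈ = ≤-trans (∑-≤1 (joins Q P w) (others OX) (λ {x} x∈ → ⟦⟧+⟦⟧≤1 (Q w x) (P x w) (λ e e′ → none x∈ w∈ e′ e)))
                             (≤-reflexive sizeX)

      no-arc : ∀ {x w} → x ∈ others OX → w ∈ others OY → P x w ≡ true ⊎ Q w x ≡ true → ⊥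
      no-arc {x} {w} x∈ w∈ (inj₁ Pxw) =
        clash (sends P x (seconds ps)) (receives Q x (seconds ps)) (sends Q w (firsts ps)) (receives P w (firsts ps))
          (splitX x∈) (splitY w∈) (3r≤ (minX x)) (3r≤ (minY w)) (few-X x∈) (few-Y w∈)
          (no-insert-after C len stuck (others⇒∉ OX x∈) (others⇒∉ OY w∈) Pxw)
          (≤r (P x) proj₂ ps len) (≤r (λ x → P x w) proj₁ ps len)
      no-arc {x} {w} x∈ w∈ (inj₂ Qwx) =
        clash (receives Q x (seconds ps)) (sends P x (seconds ps)) (receives P w (firsts ps)) (sends Q w (firsts ps))
          (trans (splitX x∈) (cong (_+ ∑ (joins P Q x) (others OY)) (+-comm (sends P x (seconds ps)) _)))
          (trans (splitY w∈) (cong (_+ ∑ (joins Q P w) (others OX)) (+-comm (sends Q w (firsts ps)) _)))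
          (3r≤ (minX x)) (3r≤ (minY w)) (few-X x∈) (few-Y w∈)
          (≤-trans (≤-reflexive (+-comm (sends P x (seconds ps)) _)) (no-insert-inside C len stuck (others⇒∉ OX x∈) (others⇒∉ OY w∈) Qwx))
          (≤r (λ y → Q y x) proj₂ ps len) (≤r (Q w) proj₁ ps len)

      -- At most 2r of the at least 3r arcs at x meet the cycle, so one stays outside, against
      -- `no-arc`.
      some-arc : ∀ {x} → x ∈ others OX → ⊥
      some-arc {x} x∈
        with w , w∈ , j ← ∑-witness (joins P Q x) (others OY)
               (some (sends P x (seconds ps)) (receives Q x (seconds ps)) (splitX x∈) (3r≤ (minX x))
                     (≤r (P x) proj₂ ps len) (≤r (λ y → Q y x) proj₂ ps len))
        = no-arc x∈ w∈ (1≤⟦⟧+⟦⟧ j)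

    outside-two-cycle : ∃₂ λ x w → x ∈ others OX × w ∈ others OY × P x w ≡ true × Q w x ≡ true
    outside-two-cycle
      with Any.any? (λ x → Any.any? (λ w → P x w Bool.≟ true ×-dec Q w x Bool.≟ true) (others OY)) (others OX)
    ... | yes a with x , x∈ , b ← find a with w , w∈ , e ← find b = x , w , x∈ , w∈ , e
    ... | no none = ⊥-elim (some-arc (λ x∈ w∈ e e′ → none (lose x∈ (lose w∈ (e , e′))))
                                     (proj₂ (nonempty (others OX) (≤-trans 0<r (≤-reflexive (sym sizeX))))))

    -- Completeness spreads from one two-cycle: its X-vertex is joined to every w, and each such w
    -- in turn to every x.
    complete : ∀ {x w} → x ∈ others OX → w ∈ others OY → P x w ≡ true × Q w x ≡ true
    complete x∈ w∈ with _ , _ , x₀∈ , w₀∈ , p , q ← outside-two-cycle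
      with p′ , q′ ← all-Y x₀∈ w₀∈ p q w∈ with q″ , p″ ← all-X x₀∈ w∈ p′ q′ x∈ = p″ , q″

    entered : Enters P Q ps → ∃ λ w → w ∈ others OY × 0 < receives P w (firsts ps)
    entered (inj₁ (x , w , x∈ , w∉ , Pxw)) = w , ∉⇒others OY w∉ ,
      ≤-trans (≤-reflexive (cong ⟦_⟧ (sym Pxw))) (∑-member (λ x → ⟦ P x w ⟧) x∈)
    -- `no-insert-after` allots r arcs to those into x and those out of w together, and y → x uses
    -- one. So w sends at most r - 1 arcs to the cycle; having at least r with it, w receives one.
    entered (inj₂ (y , x , y∈ , x∉ , Qyx)) with _ , w , _ , w∈ , _ ← outside-two-cycle
      = w , w∈ , arith (sends Q w (firsts ps)) (receives P w (firsts ps))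
          (no-insert-after C len stuck x∉ (others⇒∉ OY w∈) (proj₁ (complete (∉⇒others OX x∉) w∈))) (cycle-≥Y w∈)
          (≤-trans (≤-reflexive (cong ⟦_⟧ (sym Qyx))) (∑-member (λ y → ⟦ Q y x ⟧) y∈))
      where
      arith : ∀ {a} c d → a + c ≤ r → r ≤ c + d → 1 ≤ a → 1 ≤ d
      arith {a} c d h₁ h₂ h₃ = by-contradiction-≤ λ lt → impossible 0 (lt ⊕ h₁ ⊕ h₂ ⊕ h₃) (solve (a & c & d & r & []))

    left : Leaves P Q ps → ∃ λ x → x ∈ others OX × 0 < sends P x (seconds ps)
    left (inj₁ (x , y , x∉ , y∈ , Pxy)) = x , ∉⇒others OX x∉ ,
      ≤-trans (≤-reflexive (cong ⟦_⟧ (sym Pxy))) (∑-member (λ y → ⟦ P x y ⟧) y∈)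
    left (inj₂ (w , x , w∉ , x∈ , Qwx)) with x′ , _ , x′∈ , _ ← outside-two-cycle
      = x′ , x′∈ , arith (sends P x′ (seconds ps)) (receives Q x′ (seconds ps))
          (no-insert-after C len stuck (others⇒∉ OX x′∈) w∉ (proj₁ (complete x′∈ (∉⇒others OY w∉)))) (cycle-≥X x′∈)
          (≤-trans (≤-reflexive (cong ⟦_⟧ (sym Qwx))) (∑-member (λ x → ⟦ Q w x ⟧) x∈))
      where
      arith : ∀ {c} a b → b + c ≤ r → r ≤ a + b → 1 ≤ c → 1 ≤ a
      arith {c} a b h₁ h₂ h₃ = by-contradiction-≤ λ lt → impossible 0 (lt ⊕ h₁ ⊕ h₂ ⊕ h₃) (solve (a & b & c & r & []))

    remove : {zs : List (Fin n)} {z : Fin n} → Unique zs → z ∈ zs → length zs ≡ r →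
             ∃ λ us → Unique (z ∷ us) × (∀ {u} → u ∈ z ∷ us → u ∈ zs) × suc (length us) ≡ r
    remove {z = z} u z∈ eq with as , bs , refl ← ∈-∃++ z∈ =
      as ++ bs , Unique-resp-↭ (shift z as bs) u , (λ u∈ → ∈-resp-↭ (↭-sym (shift z as bs)) u∈) , trans (sym (↭-length (shift z as bs))) eq

  stuck-half : Enters P Q ps → Leaves P Q ps → ⊥
  stuck-half enters leaves
    with w , w∈ , into ← entered enters
    with x′ , x′∈ , out ← left leaves
    with x , x∈ , Pxw ← ∑-witness (λ x → ⟦ P x w ⟧) (firsts ps) into
    with y′ , y′∈ , Px′y′ ← ∑-witness (λ y → ⟦ P x′ y ⟧) (seconds ps) out
    with us , ux , us⊆ , lu ← remove (unique-others OX) x′∈ sizeX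
    with ws , uw , ws⊆ , lw ← remove (unique-others OY) w∈ sizeY
    with y , qs , C′ , turn ← rotate-to C x∈ = finish C′ turn (∈-resp-↭ (↭-map⁺ proj₂ turn) y′∈)
    where
    back : ∀ {qs} → ps ↭ qs → (f : Fin n × Fin n → Fin n) → ∀ {t} → t ∉ map f ps → t ∉ map f qs
    back turn f t∉ t∈ = t∉ (∈-resp-↭ (↭-map⁺ f (↭-sym turn)) t∈)
    finish : ∀ {y qs} → Cycle P Q ((x , y) ∷ qs) → ps ↭ (x , y) ∷ qs → y′ ∈ seconds ((x , y) ∷ qs) → ⊥
    -- If x′ leads to the very y that follows x, nothing is bypassed and one outside pair suffices.
    finish (cycle (hop p q w₀) u v) turn (here refl) = stuck
      ( _ , cong suc (trans (sym (↭-length turn)) len)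
      , insert-inside {as = []} u v [] p q w₀ (back turn proj₁ (others⇒∉ OX x′∈)) (back turn proj₂ (others⇒∉ OY w∈))
          (0<⟦⟧ Pxw) (proj₂ (complete x′∈ w∈)) (0<⟦⟧ Px′y′))
    finish C′ turn (there y′∈″) =
      let len′ = trans (sym (↭-length turn)) len in stuck (subst (HasCycle P Q ∘ suc) len′
      (detour C′ ux uw (suc-injective (trans lu (sym lw))) (≤-reflexive (suc-injective (trans len′ (sym lu))))
        (λ u∈ → back turn proj₁ (others⇒∉ OX (us⊆ u∈))) (λ v∈ → back turn proj₂ (others⇒∉ OY (ws⊆ v∈)))
        (λ u∈ v∈ → complete (us⊆ u∈) (ws⊆ v∈)) (0<⟦⟧ Pxw) (0<⟦⟧ Px′y′) y′∈″))

-- Paths of vertices joined both ways, and the first long cycle.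

module _ {n : ℕ} where

  flatten : Pairs n → List (V n)
  flatten []             = []
  flatten ((x , y) ∷ ps) = inj₁ x ∷ inj₂ y ∷ flatten ps

  ∈-flatten-firsts : ∀ ps {x} → x ∈ firsts ps → inj₁ x ∈ flatten ps
  ∈-flatten-firsts (_ ∷ ps) (here refl) = here refl
  ∈-flatten-firsts (_ ∷ ps) (there x∈)  = there (there (∈-flatten-firsts ps x∈))

  ∈-flatten-seconds : ∀ ps {y} → y ∈ seconds ps → inj₂ y ∈ flatten ps
  ∈-flatten-seconds (_ ∷ ps) (here refl) = there (here refl)
  ∈-flatten-seconds (_ ∷ ps) (there y∈)  = there (there (∈-flatten-seconds ps y∈))

  ∈-flatten⁻-firsts : ∀ ps {x} → inj₁ x ∈ flatten ps → x ∈ firsts ps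
  ∈-flatten⁻-firsts (_ ∷ ps) (here refl)        = here refl
  ∈-flatten⁻-firsts (_ ∷ ps) (there (there x∈)) = there (∈-flatten⁻-firsts ps x∈)

  ∈-flatten⁻-seconds : ∀ ps {y} → inj₂ y ∈ flatten ps → y ∈ seconds ps
  ∈-flatten⁻-seconds (_ ∷ ps) (there (here refl)) = here refl
  ∈-flatten⁻-seconds (_ ∷ ps) (there (there y∈))  = there (∈-flatten⁻-seconds ps y∈)

  unique-flatten⁻ : ∀ ps → Unique (flatten ps) → Unique (firsts ps) × Unique (seconds ps)
  unique-flatten⁻ [] _ = [] , []
  unique-flatten⁻ ((x , y) ∷ ps) u with u₁ , u₂ ← unique-flatten⁻ ps (Unique-tail (Unique-tail u)) =
    Unique-∷⁺ (λ x∈ → Unique-∷⁻ u (there (∈-flatten-firsts ps x∈))) u₁ ,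
    Unique-∷⁺ (λ y∈ → Unique-∷⁻ (Unique-tail u) (∈-flatten-seconds ps y∈)) u₂

  unique-flatten⁺ : ∀ ps → Unique (firsts ps) → Unique (seconds ps) → Unique (flatten ps)
  unique-flatten⁺ [] _ _ = []
  unique-flatten⁺ ((x , y) ∷ ps) u v =
    Unique-∷⁺ (λ { (there x∈) → Unique-∷⁻ u (∈-flatten⁻-firsts ps x∈) })
      (Unique-∷⁺ (λ y∈ → Unique-∷⁻ v (∈-flatten⁻-seconds ps y∈)) (unique-flatten⁺ ps (Unique-tail u) (Unique-tail v)))

Joined : ∀ {n} → Arcs n → Arcs n → V n → V n → Set
Joined P Q (inj₁ x) (inj₂ y) = P x y ≡ true × Q y x ≡ true
Joined P Q (inj₂ y) (inj₁ x) = P x y ≡ true × Q y x ≡ true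
Joined P Q (inj₁ _) (inj₁ _) = ⊥
Joined P Q (inj₂ _) (inj₂ _) = ⊥

neighbours : ∀ {n} → Arcs n → Arcs n → Fin n → List (Fin n)
neighbours {n} P Q x = filter (λ y → P x y Bool.≟ true ×-dec Q y x Bool.≟ true) (allFin n)

-- Only a vertex joined both ways counts twice. Hence degree n + k yields k such neighbours, and a
-- high vertex has n - k.
degree≤neighbours : ∀ {n} (P Q : Arcs n) x → degree P Q x ≤ n + length (neighbours P Q x)
degree≤neighbours {n} P Q x =
  ≤-trans (count (allFin n)) (≤-reflexive (cong (_+ length (neighbours P Q x)) (length-tabulate {n = n} (λ i → i))))
  where
  count : ∀ ys → ∑ (joins P Q x) ys ≤ length ys + length (filter (λ y → P x y Bool.≟ true ×-dec Q y x Bool.≟ true) ys)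
  count []       = z≤n
  count (y ∷ ys) with P x y | Q y x | count ys
  ... | true  | true  | h = ≤-trans (s≤s (s≤s h)) (≤-reflexive (cong suc (sym (+-suc (length ys) _))))
  ... | true  | false | h = s≤s h
  ... | false | true  | h = s≤s h
  ... | false | false | h = ≤-trans h (m≤n+m _ 1)

data Path {n} (P Q : Arcs n) : V n → List (V n) → V n → Set where
  end : ∀ u → Path P Q u [ u ] u
  _∷_ : ∀ {u v w vs} → Joined P Q u v → Path P Q v vs w → Path P Q u (u ∷ vs) w

module _ {n : ℕ} {P Q : Arcs n} where

  Joined-sym : ∀ {u v} → Joined P Q u v → Joined P Q v u
  Joined-sym {inj₁ _} {inj₂ _} j = j
  Joined-sym {inj₂ _} {inj₁ _} j = j

  Joined-swap : ∀ {u v} → Joined P Q u v → Joined Q P (Sum.swap u) (Sum.swap v)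
  Joined-swap {inj₁ _} {inj₂ _} (p , q) = q , p
  Joined-swap {inj₂ _} {inj₁ _} (p , q) = q , p

  path-swap : ∀ {u vs w} → Path P Q u vs w → Path Q P (Sum.swap u) (map Sum.swap vs) (Sum.swap w)
  path-swap (end u) = end (Sum.swap u)
  path-swap (_∷_ {u} {v} j p) = Joined-swap {u} {v} j ∷ path-swap p

  path-++ : ∀ {u vs v v′ ws w} → Path P Q u vs v → Joined P Q v v′ → Path P Q v′ ws w → Path P Q u (vs ++ ws) w
  path-++ (end u)  j q = j ∷ q
  path-++ (i ∷ p)  j q = i ∷ path-++ p j q

  path-reverse : ∀ {u vs w} → Path P Q u vs w → Path P Q w (reverse vs) u
  path-reverse (end u) = end u
  path-reverse (_∷_ {u} {v} {vs = vs} j p) =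
    subst (λ l → Path P Q _ l u) (sym (unfold-reverse u vs)) (path-++ (path-reverse p) (Joined-sym {u} {v} j) (end u))

  path-split : ∀ {u a w v bs} as → Path P Q u (a ∷ as ++ v ∷ bs) w →
               ∃ λ m → Path P Q u (a ∷ as) m × Joined P Q m v × Path P Q v (v ∷ bs) w
  path-split [] (j ∷ end v)   = _ , end _ , j , end v
  path-split [] (j ∷ (i ∷ p)) = _ , end _ , j , i ∷ p
  path-split (_ ∷ as) (j ∷ p) with m , p₁ , i , p₂ ← path-split as p = m , j ∷ p₁ , i , p₂

  path-head : ∀ {u v vs w} → Path P Q u (v ∷ vs) w → u ≡ v
  path-head (end _) = refl
  path-head (_ ∷ _) = refl

  path-last : ∀ {u v vs w} → Path P Q u (v ∷ vs) w → w ∈ v ∷ vs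
  path-last (end _) = here refl
  path-last (j ∷ end u)   = there (here refl)
  path-last (j ∷ (i ∷ p)) = there (path-last (i ∷ p))

  path⇒walk : ∀ {x y z vs} → Path P Q (inj₁ x) vs (inj₂ y) → Q y z ≡ true → ∃ λ ps → Walk P Q x ps z × flatten ps ≡ vs
  path⇒walk (_∷_ {v = inj₂ y} (p , _) (end _)) e = (_ , y) ∷ [] , hop p e [] , refl
  path⇒walk (_∷_ {v = inj₂ y} (p , _) (_∷_ {v = inj₁ x′} (_ , q) w)) e
    with ps , w′ , eq ← path⇒walk w e = (_ , y) ∷ ps , hop p q w′ , cong (λ l → _ ∷ _ ∷ l) eq

  -- All two-way neighbours of x lie on the resulting cycle, so r is at least their number and thus
  -- at least the degree of x minus n.
  close-path : ∀ {x y vs} → Path P Q (inj₁ x) vs (inj₂ y) → Q y x ≡ true → Unique vs →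
               (∀ {z} → z ∈ neighbours P Q x → inj₂ z ∈ vs) → ∃ λ r → HasCycle P Q r × degree P Q x ≤ n + r
  close-path {x} p e u ⊆vs with ps , w , refl ← path⇒walk p e with u₁ , u₂ ← unique-flatten⁻ ps u =
      length ps , (ps , refl , cycle w u₁ u₂)
    , ≤-trans (degree≤neighbours P Q x) (+-monoʳ-≤ n (≤-trans
        (Unique-⊆⇒length≤ (Unique.filter⁺ _ (Unique.allFin⁺ n)) (λ z∈ → ∈-flatten⁻-seconds ps (⊆vs z∈)))
        (≤-reflexive (length-map proj₂ ps))))

module _ {n k : ℕ} {P Q : Arcs n} (H : Conditions k P Q) where
  open Conditions H
  private
    infix 4 _∈?_
    _∈?_ : (v : V n) (vs : List (V n)) → Dec (v ∈ vs)
    v ∈? vs = Any.any? (Sum.≡-dec Fin._≟_ Fin._≟_ v) vs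

    degreeV : V n → ℕ
    degreeV (inj₁ x) = degree P Q x
    degreeV (inj₂ y) = degree Q P y

    HighV : V n → Set
    HighV v = 2 * n ≤ degreeV v + k

    nb : V n → List (V n)
    nb (inj₁ x) = map inj₂ (neighbours P Q x)
    nb (inj₂ y) = map inj₁ (neighbours Q P y)

    nb⇒Joined : ∀ u {v} → v ∈ nb u → Joined P Q u v
    nb⇒Joined (inj₁ x) v∈ with y , y∈ , refl ← ∈-map⁻ inj₂ v∈ =
      proj₂ (∈-filter⁻ (λ y → P x y Bool.≟ true ×-dec Q y x Bool.≟ true) {xs = allFin n} y∈)
    nb⇒Joined (inj₂ y) v∈ with x , x∈ , refl ← ∈-map⁻ inj₁ v∈ = 
      let _ , q , p = ∈-filter⁻ (λ x → Q y x Bool.≟ true ×-dec P x y Bool.≟ true) {xs = allFin n} x∈ in p , q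

    nb-unique : ∀ u → Unique (nb u)
    nb-unique (inj₁ x) = Unique.map⁺ Sum.inj₂-injective (Unique.filter⁺ _ (Unique.allFin⁺ n))
    nb-unique (inj₂ y) = Unique.map⁺ Sum.inj₁-injective (Unique.filter⁺ _ (Unique.allFin⁺ n))

    k≤nb : ∀ u → k ≤ length (nb u)
    k≤nb (inj₁ x) rewrite length-map {B = V n} inj₂ (neighbours P Q x) =
      +-cancelˡ-≤ n _ _ (≤-trans (minX x) (degree≤neighbours P Q x))
    k≤nb (inj₂ y) rewrite length-map {B = V n} inj₁ (neighbours Q P y) =
      +-cancelˡ-≤ n _ _ (≤-trans (minY y) (degree≤neighbours Q P y))

    domV : ∀ {v u u′} → Joined P Q v u → Joined P Q v u′ → u ≢ u′ → HighV u ⊎ HighV u′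
    domV {inj₁ _} {inj₂ y} {inj₂ y′} (p , _) (p′ , _) y≢y′ = domY (y≢y′ ∘ cong inj₂) p p′
    domV {inj₂ _} {inj₁ x} {inj₁ x′} (_ , q) (_ , q′) x≢x′ = domX (x≢x′ ∘ cong inj₁) q q′

    Joined-irrefl : ∀ u → ¬ Joined P Q u u
    Joined-irrefl (inj₁ _) ()
    Joined-irrefl (inj₂ _) ()

    listed : ∀ v → v ∈ map inj₁ (allFin n) ++ map inj₂ (allFin n)
    listed (inj₁ x) = ∈-++⁺ˡ (∈-map⁺ inj₁ (∈-allFin x))
    listed (inj₂ y) = ∈-++⁺ʳ (map inj₁ (allFin n)) (∈-map⁺ inj₂ (∈-allFin y))

    length≤ : {vs : List (V n)} → Unique vs → length vs ≤ 2 * n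
    length≤ u = ≤-trans (Unique-⊆⇒length≤ {zs = map inj₁ (allFin n) ++ map inj₂ (allFin n)} u (λ {v} _ → listed v))
      (≤-reflexive (trans (length-++ (map inj₁ (allFin n)))
        (cong₂ _+_ (trans (length-map inj₁ (allFin n)) (length-tabulate {n = n} (λ i → i)))
                   (trans (trans (length-map inj₂ (allFin n)) (length-tabulate {n = n} (λ i → i))) (sym (+-identityʳ n))))))

    Long : Set
    Long = ∃ λ r → HasCycle P Q r × n ≤ r + k

    long : ∀ {d r} → 2 * n ≤ d + k → d ≤ n + r → n ≤ r + k
    long {d} {r} h₁ h₂ = by-contradiction-≤ λ lt → impossible 0 (lt ⊕ h₁ ⊕ h₂) (solve (d & r & n & k & []))

    swap-injective : {u v : V n} → Sum.swap u ≡ Sum.swap v → u ≡ v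
    swap-injective {inj₁ _} {inj₁ _} refl = refl
    swap-injective {inj₂ _} {inj₂ _} refl = refl

    close-high : ∀ {u v vs} → Path P Q u vs v → Joined P Q u v → Unique vs → HighV u → (∀ {z} → z ∈ nb u → z ∈ vs) → Long
    close-high {inj₁ x} {inj₂ y} p (_ , q) u hu ⊆vs with r , c , le ← close-path p q u (⊆vs ∘ ∈-map⁺ inj₂) =
      r , c , long hu le
    close-high {inj₂ y} {inj₁ x} p (e , _) u hu ⊆vs
      with r , c , le ← close-path (path-swap p) e (Unique.map⁺ swap-injective u) (∈-map⁺ Sum.swap ∘ ⊆vs ∘ ∈-map⁺ inj₁) =
      r , flip-HasCycle c , long hu le

    -- Finds a neighbour of the path's first vertex other than the vertex next to it; reversing up
    -- to the latter would bring the same first vertex back.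
    two-elements : ∀ {m} {l : V n} {ls} (zs : List (V n)) → Unique zs → 1 < m → m ≤ length zs → (∀ {z} → z ∈ zs → z ∈ l ∷ ls) →
                   ∃ λ z → z ∈ zs × z ∈ ls
    two-elements []           u (s≤s _) () h
    two-elements (z ∷ [])     u (s≤s (s≤s _)) (s≤s ()) h
    two-elements (z ∷ z′ ∷ _) u _ _ h with h (here refl) | h (there (here refl))
    ... | there z∈  | _         = z , here refl , z∈
    ... | here _    | there z∈′ = z′ , there (here refl) , z∈′
    ... | here refl | here refl = ⊥-elim (Unique-∷⁻ u (here refl))

    -- Extend a path of vertices joined both ways at its first vertex u while possible.  When all neighbours of u
    -- lie on the path, a high u closes a long cycle; for u low, reverse the path up to a neighbour v:
    -- the new first vertex is dominated by v together with u, hence high.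
    mutual
      grow-path : ∀ m {u vs w} → Path P Q u (u ∷ vs) w → Unique (u ∷ vs) → 2 * n < suc (length vs) + m → Long
      grow-path m {u} {vs} p uniq fuel with 2 * n ≤? degreeV u + k
      ... | yes hu = grow-high-path m p uniq fuel hu
      ... | no  lu with Any.any? (λ v → ¬? (v ∈? u ∷ vs)) (nb u)
      ...   | yes a with v , v∈ , v∉ ← find a = extend m p uniq fuel v∈ v∉
      grow-path m {u} {[]} p uniq fuel | no lu | no none
        with v , v∈ , () ← two-elements (nb u) (nb-unique u) 1<k (k≤nb u) (λ {z} z∈ → inside none z∈)
      grow-path m {u} {l ∷ ls} p uniq fuel | no lu | no none
        with v , v∈ , v∈ls ← two-elements (nb u) (nb-unique u) 1<k (k≤nb u) (λ z∈ → tail∈ (nb⇒Joined u z∈) (inside none z∈))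
        with as , bs , refl ← ∈-∃++ v∈ls
        with m′ , p₁ , j , p₂ ← path-split (l ∷ as) p =
        grow-high-path′ m (path-++ (path-reverse p₁) (nb⇒Joined u v∈) p₂)
          (Unique-resp-↭ (↭-sym turn) uniq) (subst (λ t → 2 * n < t + m) (sym (↭-length turn)) fuel)
          (case domV {v} {u} {m′} (Joined-sym {u = u} {v} (nb⇒Joined u v∈)) (Joined-sym {u = m′} {v} j)
                     (λ { refl → Unique-∷⁻ uniq (∈-++⁺ˡ {xs = l ∷ as} (last∈ p₁)) }) of λ where
             (inj₁ hu) → ⊥-elim (lu hu)
             (inj₂ hm) → hm)
        where
        turn : reverse (u ∷ l ∷ as) ++ v ∷ bs ↭ u ∷ l ∷ as ++ v ∷ bs
        turn = ++⁺ʳ (v ∷ bs) (↭-reverse (u ∷ l ∷ as))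
        last∈ : ∀ {u l as m} → Path P Q u (u ∷ l ∷ as) m → m ∈ l ∷ as
        last∈ (_ ∷ p) = path-last p

      inside : ∀ {u vs} → ¬ Any (λ v → v ∉ u ∷ vs) (nb u) → ∀ {z} → z ∈ nb u → z ∈ u ∷ vs
      inside {u} {vs} none {z} z∈ = decidable-stable (z ∈? u ∷ vs) λ z∉ → none (lose z∈ z∉)

      tail∈ : ∀ {u z vs} → Joined P Q u z → z ∈ u ∷ vs → z ∈ vs
      tail∈ {u} j (here refl) = ⊥-elim (Joined-irrefl u j)
      tail∈     j (there z∈)  = z∈

      extend : ∀ m {u vs w v} → Path P Q u (u ∷ vs) w → Unique (u ∷ vs) → 2 * n < suc (length vs) + m →
               v ∈ nb u → v ∉ u ∷ vs → Long
      -- With no fuel left the path would have more than 2n distinct vertices.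
      extend zero    {vs = vs} p uniq fuel v∈ v∉ =
        ⊥-elim (<⇒≱ fuel (≤-trans (≤-reflexive (+-identityʳ (suc (length vs)))) (length≤ uniq)))
      extend (suc m) {u} {vs} {v = v} p uniq fuel v∈ v∉ =
        grow-path m (Joined-sym {u = u} {v} (nb⇒Joined u v∈) ∷ p) (Unique-∷⁺ v∉ uniq)
          (subst (2 * n <_) (+-suc (suc (length vs)) m) fuel)

      grow-high-path : ∀ m {u vs w} → Path P Q u (u ∷ vs) w → Unique (u ∷ vs) → 2 * n < suc (length vs) + m → HighV u → Long
      grow-high-path m {u} {vs} p uniq fuel hu with Any.any? (λ v → ¬? (v ∈? u ∷ vs)) (nb u)
      ... | yes a with v , v∈ , v∉ ← find a = extend m p uniq fuel v∈ v∉
      ... | no none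
        with z , z∈ ← nonempty (nb u) (≤-trans (<⇒≤ 1<k) (k≤nb u))
        -- The path is cut at the last neighbour of u, so that the cycle keeps all of them.
        with as , v , bs , refl , v∈ , last ← last-satisfying (_∈? nb u) vs (lose (tail∈ (nb⇒Joined u z∈) (inside none z∈)) z∈)
        with m′ , p₁ , j , _ ← path-split as p =
        close-high (path-++ p₁ j (end v)) (nb⇒Joined u v∈)
          (Unique-++⁻ˡ (u ∷ as ++ [ v ]) (subst Unique (sym (++-assoc (u ∷ as) [ v ] bs)) uniq)) hu
          λ {t} t∈ → case ∈-++⁻ (u ∷ as) (inside none t∈) of λ where
            (inj₁ q)           → ∈-++⁺ˡ q
            (inj₂ (here refl)) → ∈-++⁺ʳ (u ∷ as) (here refl)
            (inj₂ (there t∈bs)) → ⊥-elim (last t∈bs t∈)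

      grow-high-path′ : ∀ m {u vs w} → Path P Q u vs w → Unique vs → 2 * n < length vs + m → HighV u → Long
      grow-high-path′ m {vs = v ∷ vs} p uniq fuel hu with refl ← path-head p = grow-high-path m p uniq fuel hu

  long-cycle : Fin n → ∃ λ r → HasCycle P Q r × n ≤ r + k
  long-cycle x = grow-path (2 * n) (end (inj₁ x)) ([] ∷ []) ≤-refl

-- All cycle lengths under the degree conditions.

module _ {n k : ℕ} {P Q : Arcs n} where

  degree≤sends : ∀ x → degree P Q x ≤ sends P x (allFin n) + n
  degree≤sends x = ≤-trans (≤-reflexive (∑-+ (λ y → ⟦ P x y ⟧) (λ y → ⟦ Q y x ⟧) (allFin n)))
    (+-monoʳ-≤ (sends P x (allFin n)) (≤-trans (∑-≤1 (λ y → ⟦ Q y x ⟧) (allFin n) (λ {y} _ → ⟦⟧≤1 (Q y x)))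
      (≤-reflexive (length-tabulate {n = n} (λ i → i)))))

  not-one-out : 1 < k → ∀ x → n + k ≤ degree P Q x → ¬ (∀ {y y′} → P x y ≡ true → P x y′ ≡ true → y ≡ y′)
  not-one-out 1<k x h one =
    arith (≤-trans h (degree≤sends x)) (∑-atMostOne (P x) (allFin n) (Unique.allFin⁺ n) (λ _ _ → one))
    where
    arith : ∀ {s} → n + k ≤ s + n → s ≤ 1 → ⊥
    arith {s} h₁ h₂ = impossible 0 (h₁ ⊕ h₂ ⊕ 1<k) (solve (s & n & k & []))

module _ {n k : ℕ} {P Q : Arcs n} (H : Conditions k P Q) where
  open Conditions H

  -- y has out-degree at least k > 1, and any two of its out-neighbours form a dominated pair.
  some-high : Fin n → ∃ (High k P Q)
  some-high y with Fin.any? (λ x → 2 * n ≤? degree P Q x + k)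
  ... | yes h = h
  ... | no none = ⊥-elim (not-one-out {P = Q} {P} 1<k y (minY y) λ {x} {x′} q q′ →
          decidable-stable (x Fin.≟ x′) λ x≢x′ → Sum.[ (λ h → none (x , h)) , (λ h → none (x′ , h)) ] (domX x≢x′ q q′))

  module _ (v₀ : Fin n) (crossing : ∀ {ps} → Cycle P Q ps → 0 < length ps → length ps < n → Enters P Q ps × Leaves P Q ps) where

    enlarge : ∀ {r} → n ≤ r + k → r < n → HasCycle P Q r → HasCycle P Q (suc r)
    enlarge {r} n≤r+k r<n (ps , len , C) with n <? 2 * r
    ... | yes n<2r = grow H C len n<2r r<n
    -- n ≤ r + k and 2k ≤ n give n ≤ 2r; so here 2r = n, and n ≤ r + k then reads r ≤ k.
    ... | no  n≮2r = decidable-stable (hasCycle? P Q (suc r)) λ stuck →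
            let enters , leaves = crossing C (subst (0 <_) (sym len) positive) (subst (_< n) (sym len) r<n)
            in stuck-half H C len r≤k 2r≡n stuck enters leaves
      where
      n≤2r : n ≤ 2 * r
      n≤2r = by-contradiction-≤ λ lt → impossible 0 (lt ⊕ n≤r+k ⊕ n≤r+k ⊕ 2k≤n) (solve (r & n & k & []))
      2r≡n : 2 * r ≡ n
      2r≡n = ≤-antisym (≮⇒≥ n≮2r) n≤2r
      r≤k : r ≤ k
      r≤k = by-contradiction-≤ λ lt → impossible 0 (lt ⊕ n≤r+k ⊕ ≤-reflexive 2r≡n) (solve (r & n & k & []))
      positive : 0 < r
      positive = by-contradiction-≤ λ lt → impossible 1 (lt ⊕ n≤r+k ⊕ 2k≤n ⊕ 1<k) (solve (r & n & k & []))

    climb : ∀ {r} → n ≤ r + k → HasCycle P Q r → ∀ d → r + d ≤ n → HasCycle P Q (r + d)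
    climb {r} h c zero    le rewrite +-identityʳ r = c
    climb {r} h c (suc d) le rewrite +-suc r d =
      enlarge (≤-trans h (+-monoˡ-≤ k (m≤m+n r d))) le (climb h c d (<⇒≤ le))

    -- Growing must pass through n - 1 pairs, the source of all shorter cycles; a start at n would
    -- skip it.
    long-non-spanning : ∃ λ r → HasCycle P Q r × n ≤ r + k × r < n
    long-non-spanning with r , (ps , refl , C) , h ← long-cycle H v₀
      with m≤n⇒m<n∨m≡n (≤-trans (≤-reflexive (sym (length-map proj₁ ps))) (Unique⇒length≤ (unique-firsts C)))
    ... | inj₁ r<n = r , (ps , refl , C) , h , r<n
    ... | inj₂ r≡n with x , hx ← some-high v₀ with n ∸ k in eq
    ...   | zero  = ⊥-elim (tiny (m∸n≡0⇒m≤n eq))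
      where
      tiny : n ≤ k → ⊥
      tiny h′ = impossible 1 (h′ ⊕ 2k≤n ⊕ 1<k) (solve (n & k & []))
    ...   | suc p = suc p , below-spanning C r≡n hx total , ≤-reflexive (sym total) , below-n total
      where
      total : suc p + k ≡ n
      total = trans (cong (_+ k) (sym eq)) (m∸n+n≡m {n} {k} (≤-trans (m≤m+n k (k + 0)) 2k≤n))
      below-n : suc p + k ≡ n → suc p < n
      below-n e = by-contradiction-≤ λ lt → impossible 1 (lt ⊕ ≤-reflexive e ⊕ 1<k) (solve (p & n & k & []))

    -- One vertex of Y is off the cycle, so an x off it has at least n + k - 2 > n - 1 = m arcs with
    -- the cycle.
    shorter : ∀ {m} → suc m ≡ n → HasCycle P Q m → ∀ p → p < m → HasCycle P Q (suc p)
    shorter m+1≡n (ps , refl , C) = let x , x∈ = nonempty (others O) 0<others in below C (others⇒∉ O x∈)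
      (arith (sends P x (seconds ps) + receives Q x (seconds ps)) (degree-split P Q x O′)
        (∑-≤ (joins P Q x) 2 (others O′) (λ {y} _ → joins≤2 P Q x y)) (minX x) (size-others proj₂ ps refl O′))
      where
      O = outside (unique-firsts C)
      O′ = outside (unique-seconds C)
      0<others : 0 < length (others O)
      0<others = by-contradiction-≤ λ lt →
        impossible 0 (lt ⊕ ≤-reflexive m+1≡n ⊕ ≤-reflexive (sym (size-others proj₁ ps refl O))) (shape (length (others O)) (length ps) n)
        where
        shape : ∀ o m n → suc o + (suc m + n) ≡ suc (1 + (n + (m + o)) + 0)
        shape = solve-∀
      arith : ∀ {d o l} s → d ≡ s + o → o ≤ l * 2 → n + k ≤ d → length ps + l ≡ n → length ps < s
      arith {o = o} {l} s refl h₁ h₂ e = bound (length ps) m+1≡n e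
        where
        bound : ∀ m → suc m ≡ n → m + l ≡ n → m < s
        bound m e₁ e₂ = by-contradiction-≤ λ lt →
          impossible 0 (lt ⊕ h₁ ⊕ h₂ ⊕ ≤-reflexive e₂ ⊕ ≤-reflexive e₂ ⊕ ≤-reflexive (sym e₁) ⊕ 1<k) (solve (s & o & l & m & n & k & []))

    reach : ∀ {r m} → HasCycle P Q r → n ≤ r + k → r ≤ m → m ≤ n → HasCycle P Q m
    reach {r} {m} c h r≤m m≤n =
      subst (HasCycle P Q) (m+[n∸m]≡n r≤m) (climb h c (m ∸ r) (≤-trans (≤-reflexive (m+[n∸m]≡n r≤m)) m≤n))

    predecessor : ∀ {s n} → s < n → ∃ λ m → suc m ≡ n × s ≤ m
    predecessor (s≤s le) = _ , refl , le

    all-cycles : ∀ s → 1 ≤ s → s ≤ n → HasCycle P Q s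
    all-cycles (suc p) _ s≤n with r , c , h , r<n ← long-non-spanning with m≤n⇒m<n∨m≡n s≤n
    ... | inj₂ s≡n = reach c h (≤-trans (<⇒≤ r<n) (≤-reflexive (sym s≡n))) s≤n
    ... | inj₁ s<n with m , m+1≡n , p<m ← predecessor s<n =
      shorter m+1≡n (reach c h (≤-pred (≤-trans r<n (≤-reflexive (sym m+1≡n)))) (≤-trans (m≤n+m m 1) (≤-reflexive m+1≡n))) p p<m

-- From digraphs to pairs of arc relations and back.

countFin-tabulate : ∀ {A : Set} {n} (f : A → Bool) (g : Fin n → A) → countFin (f ∘ g) ≡ ∑ (⟦_⟧ ∘ f) (tabulate g)
countFin-tabulate {n = zero}  f g = refl
countFin-tabulate {n = suc n} f g with f (g zero)
... | true  = cong suc (countFin-tabulate f (g ∘ suc))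
... | false = countFin-tabulate f (g ∘ suc)

countFin-none : ∀ {n} (f : Fin n → Bool) → (∀ i → f i ≡ false) → countFin f ≡ 0
countFin-none {zero}  f h = refl
countFin-none {suc n} f h rewrite h zero = countFin-none (f ∘ suc) (h ∘ suc)

any-vertex? : ∀ {a} {R : V a → Set} → Decidable R → Dec (∃ R)
any-vertex? R? = map′ (Sum.[ (λ (x , r) → inj₁ x , r) , (λ (y , r) → inj₂ y , r) ])
                      (λ { (inj₁ x , r) → inj₁ (x , r) ; (inj₂ y , r) → inj₂ (y , r) })
                      (Fin.any? (R? ∘ inj₁) ⊎-dec Fin.any? (R? ∘ inj₂))

infix 4 _≟V_
_≟V_ : ∀ {a} (u v : V a) → Dec (u ≡ v)
_≟V_ = Sum.≡-dec Fin._≟_ Fin._≟_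

crossing-step : ∀ {A : Set} {R : A → A → Set} {S : A → Set} → Decidable S → ∀ {u v} → Star R u v → S u → ¬ S v →
                ∃₂ λ c d → S c × ¬ S d × R c d
crossing-step S? ε Su ¬Sv = ⊥-elim (¬Sv Su)
crossing-step S? (_◅_ {u} {t} e s) Su ¬Sv with S? t
... | yes St = crossing-step S? s St ¬Sv
... | no ¬St = u , t , Su , ¬St , e

lookup-injective : {A : Set} {xs : List A} → Unique xs → ∀ {i j} → lookup xs i ≡ lookup xs j → i ≡ j
lookup-injective (_ ∷ u)           {zero}  {zero}  _ = refl
lookup-injective {xs = x ∷ xs} u   {zero}  {suc j} e = ⊥-elim (Unique-∷⁻ u (subst (_∈ xs) (sym e) (∈-lookup j)))
lookup-injective {xs = x ∷ xs} u   {suc i} {zero}  e = ⊥-elim (Unique-∷⁻ u (subst (_∈ xs) e (∈-lookup i)))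
lookup-injective (_ ∷ u)           {suc i} {suc j} e = cong suc (lookup-injective u e)

module _ {a : ℕ} (D : BipDigraph a) where

  arcsXY arcsYX : Arcs a
  arcsXY x y = arc D (inj₁ x) (inj₂ y)
  arcsYX y x = arc D (inj₂ y) (inj₁ x)

  deg-X : ∀ x → deg D (inj₁ x) ≡ degree arcsXY arcsYX x
  deg-X x rewrite countFin-none (λ i → arc D (inj₁ x) (inj₁ i)) (noArcXX D x)
                | countFin-none (λ i → arc D (inj₁ i) (inj₁ x)) (λ i → noArcXX D i x)
                | countFin-tabulate (λ y → arcsXY x y) (λ i → i) | countFin-tabulate (λ y → arcsYX y x) (λ i → i) =
    sym (∑-+ (λ y → ⟦ arcsXY x y ⟧) (λ y → ⟦ arcsYX y x ⟧) (allFin a))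

  deg-Y : ∀ y → deg D (inj₂ y) ≡ degree arcsYX arcsXY y
  deg-Y y rewrite countFin-none (λ i → arc D (inj₂ y) (inj₂ i)) (noArcYY D y)
                | countFin-none (λ i → arc D (inj₂ i) (inj₂ y)) (λ i → noArcYY D i y)
                | countFin-tabulate (λ x → arcsYX y x) (λ i → i) | countFin-tabulate (λ x → arcsXY x y) (λ i → i)
                | +-identityʳ (∑ (⟦_⟧ ∘ arcsYX y) (allFin a)) | +-identityʳ (∑ (λ x → ⟦ arcsXY x y ⟧) (allFin a)) =
    sym (∑-+ (λ x → ⟦ arcsYX y x ⟧) (λ x → ⟦ arcsXY x y ⟧) (allFin a))

  noXX : ∀ {x x′} → ¬ Arc D (inj₁ x) (inj₁ x′)
  noXX {x} {x′} e with () ← trans (sym e) (noArcXX D x x′)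

  noYY : ∀ {y y′} → ¬ Arc D (inj₂ y) (inj₂ y′)
  noYY {y} {y′} e with () ← trans (sym e) (noArcYY D y y′)

  data Trail : V a → List (V a) → V a → Set where
    []  : ∀ {z} → Trail z [] z
    _∷_ : ∀ {u v z vs} → Arc D u v → Trail v vs z → Trail u (u ∷ vs) z

  walk⇒trail : ∀ {x ps z} → Walk arcsXY arcsYX x ps z → Trail (inj₁ x) (flatten ps) (inj₁ z)
  walk⇒trail []          = []
  walk⇒trail (hop p q w) = p ∷ q ∷ walk⇒trail w

  trail-step : ∀ {u v vs z} → Trail u (v ∷ vs) z → ∀ (i : Fin (length vs)) →
               Arc D (lookup (v ∷ vs) (inject₁ i)) (lookup (v ∷ vs) (suc i))
  trail-step {vs = _ ∷ _} (e ∷ (_ ∷ _))   zero    = e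
  trail-step {vs = _ ∷ _} (e ∷ t@(_ ∷ _)) (suc i) = trail-step t i

  trail-close : ∀ {u v vs z} → Trail u (v ∷ vs) z → Arc D (lookup (v ∷ vs) (fromℕ (length vs))) z
  trail-close (e ∷ [])        = e
  trail-close (_ ∷ t@(_ ∷ _)) = trail-close t

  trail⇒cycle : ∀ {v vs} → Trail v (v ∷ vs) v → Unique (v ∷ vs) → HasCycleOfLength D (length (v ∷ vs))
  trail⇒cycle {v} {vs} t u = record
    { vtx = lookup (v ∷ vs) ; inj = lookup-injective u ; step = trail-step t ; close = trail-close t }

  HasCycle⇒HasCycleOfLength : ∀ {t} → 1 ≤ t → HasCycle arcsXY arcsYX t → HasCycleOfLength D (2 * t)
  HasCycle⇒HasCycleOfLength 1≤t (ps , refl , cycle w@(hop {ps = qs} _ _ _) u v) =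
    subst (HasCycleOfLength D) (length-flatten ps) (trail⇒cycle (walk⇒trail w) (unique-flatten⁺ ps u v))
    where
    length-flatten : ∀ qs → length (flatten qs) ≡ 2 * length qs
    length-flatten []       = refl
    length-flatten (_ ∷ qs) = cong suc (trans (cong suc (length-flatten qs)) (sym (+-suc (length qs) (length qs + 0))))

  module _ (strong : StronglyConnected D) where

    cross : ∀ {ps} → Cycle arcsXY arcsYX ps → 0 < length ps → length ps < a →
            Enters arcsXY arcsYX ps × Leaves arcsXY arcsYX ps
    cross {ps} C 0<len len<a = enters , leaves
      where
      On : V a → Set
      On (inj₁ x) = x ∈ firsts ps
      On (inj₂ y) = y ∈ seconds ps
      On? : Decidable On
      On? (inj₁ x) = Any.any? (x Fin.≟_) (firsts ps)
      On? (inj₂ y) = Any.any? (y Fin.≟_) (seconds ps)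
      on : ∃ (_∈ firsts ps)
      on = nonempty (firsts ps) (≤-trans 0<len (≤-reflexive (sym (length-map proj₁ ps))))
      O = outside (unique-firsts C)
      0<others : ∀ m l → m < a → m + l ≡ a → 0 < l
      0<others m l h e = by-contradiction-≤ λ lt → impossible 0 (lt ⊕ h ⊕ ≤-reflexive (sym e)) (solve (m & l & a & []))
      off : ∃ (_∈ others O)
      off = nonempty (others O) (0<others (length ps) _ len<a (size-others proj₁ ps refl O))
      enters : Enters arcsXY arcsYX ps
      enters with crossing-step On? (strong (inj₁ (proj₁ on)) (inj₁ (proj₁ off))) (proj₂ on) (others⇒∉ O (proj₂ off))
      ... | inj₁ x , inj₂ w , x∈ , w∉ , e = inj₁ (x , w , x∈ , w∉ , e)
      ... | inj₂ y , inj₁ x , y∈ , x∉ , e = inj₂ (y , x , y∈ , x∉ , e)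
      ... | inj₁ _ , inj₁ _ , _  , _  , e = ⊥-elim (noXX e)
      ... | inj₂ _ , inj₂ _ , _  , _  , e = ⊥-elim (noYY e)
      leaves : Leaves arcsXY arcsYX ps
      leaves with crossing-step (¬? ∘ On?) (strong (inj₁ (proj₁ off)) (inj₁ (proj₁ on))) (others⇒∉ O (proj₂ off)) (λ n → n (proj₂ on))
      ... | inj₁ x , inj₂ y , x∉ , ¬y∉ , e = inj₁ (x , y , x∉ , decidable-stable (On? (inj₂ y)) ¬y∉ , e)
      ... | inj₂ w , inj₁ x , w∉ , ¬x∉ , e = inj₂ (w , x , w∉ , decidable-stable (On? (inj₁ x)) ¬x∉ , e)
      ... | inj₁ _ , inj₁ _ , _  , _  , e = ⊥-elim (noXX e)
      ... | inj₂ _ , inj₂ _ , _  , _  , e = ⊥-elim (noYY e)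

    module _ {k : ℕ} (1<k : 1 < k) (2k≤a : 2 * k ≤ a)
             (degrees : ∀ u v → Dominated D u v → (2 * a ≤ deg D u + k × a + k ≤ deg D v) ⊎ (a + k ≤ deg D u × 2 * a ≤ deg D v + k)) where

      -- The higher bound implies the lower one, since 2k ≤ a gives 2a - k ≥ a + k.
      dominated⇒degree : ∀ {w u v} → u ≢ v → Arc D w u → Arc D w v → a + k ≤ deg D u
      dominated⇒degree {w} {u} {v} u≢v e e′ with degrees u v (u≢v , w , e , e′)
      ... | inj₂ (h , _) = h
      ... | inj₁ (h , _) = by-contradiction-≤ λ lt → arith (deg D u) lt h
        where
        arith : ∀ d → d < a + k → 2 * a ≤ d + k → ⊥
        arith d h₁ h₂ = impossible 0 (h₁ ⊕ h₂ ⊕ 2k≤a) (solve (d & a & k & []))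

      not-only-out : ∀ u {v} → a + k ≤ deg D u → ¬ (∀ {v′} → Arc D u v′ → v ≡ v′)
      not-only-out (inj₁ x) h only = not-one-out {P = arcsXY} {arcsYX} 1<k x (subst (a + k ≤_) (deg-X x) h)
        λ p q → Sum.inj₂-injective (trans (sym (only p)) (only q))
      not-only-out (inj₂ y) h only = not-one-out {P = arcsYX} {arcsXY} 1<k y (subst (a + k ≤_) (deg-Y y) h)
        λ p q → Sum.inj₁-injective (trans (sym (only p)) (only q))

      -- A vertex of degree at least a + k dominates each of its out-neighbours together with another one.
      degree-step : ∀ {u v} → Arc D u v → a + k ≤ deg D u → a + k ≤ deg D v
      degree-step {u} {v} e h with any-vertex? (λ v′ → ¬? (v ≟V v′) ×-dec (arc D u v′ Bool.≟ true))
      ... | yes (v′ , v≢v′ , e′) = dominated⇒degree v≢v′ e e′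
      ... | no none = ⊥-elim (not-only-out u h λ {v′} e′ → decidable-stable (v ≟V v′) λ v≢v′ → none (v′ , v≢v′ , e′))

      degree-spreads : ∀ {u v} → Star (Arc D) u v → a + k ≤ deg D u → a + k ≤ deg D v
      degree-spreads ε       h = h
      degree-spreads (e ◅ s) h = degree-spreads s (degree-step e h)

      conditions : ∀ {w u v} → u ≢ v → Arc D w u → Arc D w v → Conditions k arcsXY arcsYX
      conditions {u = u} u≢v e e′ = record
        { 1<k  = 1<k
        ; 2k≤n = 2k≤a
        ; minX = λ x → subst (a + k ≤_) (deg-X x) (degree-spreads (strong u (inj₁ x)) h)
        ; minY = λ y → subst (a + k ≤_) (deg-Y y) (degree-spreads (strong u (inj₂ y)) h)
        ; domX = λ {y} {x} {x′} x≢x′ p q →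
            Sum.map (λ (g , _) → subst (λ d → 2 * a ≤ d + k) (deg-X x) g) (λ (_ , g) → subst (λ d → 2 * a ≤ d + k) (deg-X x′) g)
              (degrees (inj₁ x) (inj₁ x′) ((x≢x′ ∘ Sum.inj₁-injective) , inj₂ y , p , q))
        ; domY = λ {x} {y} {y′} y≢y′ p q →
            Sum.map (λ (g , _) → subst (λ d → 2 * a ≤ d + k) (deg-Y y) g) (λ (_ , g) → subst (λ d → 2 * a ≤ d + k) (deg-Y y′) g)
              (degrees (inj₂ y) (inj₂ y′) ((y≢y′ ∘ Sum.inj₂-injective) , inj₁ x , p , q))
        }
        where h = dominated⇒degree u≢v e e′

      bipancyclic : Fin a → ∀ {w u v} → u ≢ v → Arc D w u → Arc D w v → Bipancyclic D
      bipancyclic x u≢v e e′ t 1≤t t≤a =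
        HasCycle⇒HasCycleOfLength 1≤t (all-cycles (conditions u≢v e e′) x cross t 1≤t t≤a)

-- Out-degree at most one.

-- With at most one arc out of every vertex, the strongly connected digraph is a single orbit of the successor map.
module _ {a′ : ℕ} (D : BipDigraph (suc a′)) (strong : StronglyConnected D)
         (functional : ∀ {w u v} → Arc D w u → Arc D w v → u ≡ v) where
  private
    N = suc a′ + suc a′

    first-arc : ∀ {u v} → u ≢ v → Star (Arc D) u v → ∃ (Arc D u)
    first-arc u≢v ε       = ⊥-elim (u≢v refl)
    first-arc u≢v (e ◅ _) = _ , e

    out : ∀ v → ∃ (Arc D v)
    -- A target on the other side differs from the vertex, so the path to it has a first arc.
    out (inj₁ x) = first-arc {v = inj₂ zero} (λ ()) (strong _ _)
    out (inj₂ y) = first-arc {v = inj₁ zero} (λ ()) (strong _ _)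

    next : V (suc a′) → V (suc a′)
    next v = proj₁ (out v)

    iterate : ℕ → V (suc a′) → V (suc a′)
    iterate zero    v = v
    iterate (suc i) v = next (iterate i v)

    iterate-next : ∀ i v → iterate i (next v) ≡ next (iterate i v)
    iterate-next zero    v = refl
    iterate-next (suc i) v = cong next (iterate-next i v)

    iterate-+ : ∀ i j v → iterate (i + j) v ≡ iterate i (iterate j v)
    iterate-+ zero    j v = refl
    iterate-+ (suc i) j v = cong next (iterate-+ i j v)

    reached : ∀ {u v} → Star (Arc D) u v → ∃ λ i → v ≡ iterate i u
    reached ε = 0 , refl
    reached (_◅_ {u} e s) with i , refl ← reached s with refl ← functional e (proj₂ (out u)) = suc i , iterate-next i u

    module _ {w p} (periodic : iterate (suc p) w ≡ w) where

      reduce : ∀ i → ∃ λ t → t < suc p × iterate i w ≡ iterate t w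
      reduce zero = 0 , s≤s z≤n , refl
      reduce (suc i) with t , t<p , eq ← reduce i with m≤n⇒m<n∨m≡n t<p
      ... | inj₁ t+1<p = suc t , t+1<p , cong next eq
      ... | inj₂ refl  = 0 , s≤s z≤n , trans (cong next eq) periodic

      index : ∀ u → ∃ λ t → t < suc p × u ≡ iterate t w
      index u with i , refl ← reached (strong w u) = reduce i

      -- Every vertex is among the first p + 1 iterates of w and is determined by its index there;
      -- with fewer than N indices two vertices would coincide.
      N≤period : N ≤ suc p
      N≤period = by-contradiction-≤ λ lt →
        let i , j , i<j , eq = Fin.pigeonhole lt λ i → Fin.fromℕ< (proj₁ (proj₂ (index (Fin.splitAt (suc a′) i))))
            t≡ = trans (sym (Fin.toℕ-fromℕ< _)) (trans (cong Fin.toℕ eq) (Fin.toℕ-fromℕ< _))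
            u≡v = trans (proj₂ (proj₂ (index (Fin.splitAt (suc a′) i))))
                    (trans (cong (λ t → iterate t w) t≡) (sym (proj₂ (proj₂ (index (Fin.splitAt (suc a′) j))))))
        in Fin.<⇒≢ i<j (trans (sym (Fin.join-splitAt (suc a′) (suc a′) i))
             (trans (cong (Fin.join (suc a′) (suc a′)) u≡v) (Fin.join-splitAt (suc a′) (suc a′) j)))

    v₀ : V (suc a′)
    v₀ = inj₁ zero

    recurrence : ∀ {i j} → i < j → iterate i v₀ ≡ iterate j v₀ → N ≤ j ∸ i
    recurrence {i} {j} i<j eq with j ∸ i in d
    ... | zero  = ⊥-elim (<⇒≱ i<j (m∸n≡0⇒m≤n d))
    ... | suc p = N≤period (trans (sym (iterate-+ (suc p) i v₀))
                    (trans (cong (λ t → iterate t v₀) (trans (cong (_+ i) (sym d)) (m∸n+n≡m (<⇒≤ i<j)))) (sym eq)))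

    distinct : ∀ {i j} → i < j → j < N → iterate i v₀ ≢ iterate j v₀
    distinct {i} {j} i<j j<N eq = <⇒≱ j<N (≤-trans (recurrence i<j eq) (m∸n≤m j i))

    -- Of the N + 1 iterates up to N, two coincide; their distance is a period, hence at least N,
    -- which leaves only 0 and N.
    returns : iterate N v₀ ≡ v₀
    returns with i , j , i<j , eq ← Fin.pigeonhole {N} {suc N} ≤-refl (λ i → Fin.join (suc a′) (suc a′) (iterate (Fin.toℕ i) v₀))
      = back (Fin.toℕ i) (Fin.toℕ j) i<j (≤-pred (Fin.toℕ<n j))
          (trans (sym (Fin.splitAt-join (suc a′) (suc a′) _)) (trans (cong (Fin.splitAt (suc a′)) eq) (Fin.splitAt-join (suc a′) (suc a′) _)))
      where
      back : ∀ i j → i < j → j ≤ N → iterate i v₀ ≡ iterate j v₀ → iterate N v₀ ≡ v₀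
      back zero    j i<j j≤N eq with refl ← ≤-antisym j≤N (recurrence i<j eq) = sym eq
      back (suc i) (suc j) i<j j<N eq = ⊥-elim (<⇒≱ j<N (≤-trans (recurrence i<j eq) (m∸n≤m j i)))

  functional⇒IsDirectedCycle : IsDirectedCycle D
  functional⇒IsDirectedCycle = C , on-cycle
    where
    vertex : Fin N → V (suc a′)
    vertex i = iterate (Fin.toℕ i) v₀
    C : CycleOf D (a′ + suc a′)
    C = record
      { vtx   = vertex
      ; inj   = λ {i} {j} eq → case Fin.<-cmp i j of λ where
          (tri< i<j _ _) → ⊥-elim (distinct i<j (Fin.toℕ<n j) eq)
          (tri≈ _ i≡j _) → i≡j
          (tri> _ _ j<i) → ⊥-elim (distinct j<i (Fin.toℕ<n i) (sym eq))
      ; step  = λ i → subst (λ t → Arc D (iterate t v₀) (iterate (suc (Fin.toℕ i)) v₀)) (sym (Fin.toℕ-inject₁ i)) (proj₂ (out _))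
      ; close = subst (Arc D _) (trans (cong (λ t → next (iterate t v₀)) (Fin.toℕ-fromℕ (a′ + suc a′))) returns) (proj₂ (out _))
      }
    on-cycle : ∀ u v → Arc D u v →
      (∃ λ (i : Fin (a′ + suc a′)) → u ≡ vertex (inject₁ i) × v ≡ vertex (suc i)) ⊎
      (u ≡ vertex (fromℕ (a′ + suc a′)) × v ≡ vertex zero)
    on-cycle u v e with t , s≤s t≤ , u≡ ← index {v₀} returns u with m≤n⇒m<n∨m≡n t≤
    ... | inj₁ t< = inj₁ (Fin.fromℕ< t<
                    , trans u≡ (cong (λ t → iterate t v₀) (sym (trans (Fin.toℕ-inject₁ _) (Fin.toℕ-fromℕ< t<))))
                    , trans (functional e (proj₂ (out u)))
                        (cong next (trans u≡ (cong (λ t → iterate t v₀) (sym (Fin.toℕ-fromℕ< t<))))))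
    ... | inj₂ refl = inj₂ (trans u≡ (cong (λ t → iterate t v₀) (sym (Fin.toℕ-fromℕ (a′ + suc a′))))
                    , trans (functional e (proj₂ (out u))) (trans (cong next u≡) returns))

theorem5p1 : (a : ℕ) → 3 ≤ a → (k : ℕ) → 1 < k → a < 4 * k → 2 * k ≤ a →
    (D : BipDigraph a) → StronglyConnected D →
    (∀ u v → Dominated D u v →
    (2 * a ≤ deg D u + k × a + k ≤ deg D v)
    ⊎ (a + k ≤ deg D u × 2 * a ≤ deg D v + k)) →
    Bipancyclic D ⊎ IsDirectedCycle D
theorem5p1 (suc a′) 3≤a k 1<k a<4k 2k≤a D strong degrees
  with any-vertex? (λ w → any-vertex? λ u → any-vertex? λ v →
         ¬? (u ≟V v) ×-dec (arc D w u Bool.≟ true) ×-dec (arc D w v Bool.≟ true))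
... | yes (w , u , v , u≢v , e , e′) = inj₁ (bipancyclic D strong 1<k 2k≤a degrees zero u≢v e e′)
... | no none = inj₂ (functional⇒IsDirectedCycle D strong λ {w} {u} {v} e e′ →
        decidable-stable (u ≟V v) λ u≢v → none (w , u , v , u≢v , e , e′))
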